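{- Let $k\ge 3$ be an integer and put $$p=1-\frac1k,\qquad \lambda=\frac{1}{10}-\frac{1}{2k}+\frac{1}{k^2}-\frac{1}{k^3}+\frac{2}{5k^4}.$$ Then $d_{C_5}(p)=\lambda$.
   Context: All graphs are finite and simple. For graphs $G$ and $H$, $\nu_H(G)$ denotes the number of (not necessarily induced) copies of $H$ in $G$, i.e. the number of subgraphs of $G$ isomorphic to $H$, and $d_H(G)=\nu_H(G)/|V(G)|^{|V(H)|}$. $C_5$ is the cycle on $5$ vertices. For $p\in[0,1]$, $d_{C_5}(p)=\lim_{n\to\infty}\min_G d_{C_5}(G)$, where the minimum is over all graphs $G$ of order $n$ with $(p+o(1))\binom n2$ edges (the limit exists); equivalently, $d_{C_5}(p)$ is the infimum of $\liminf_{n\to\infty} d_{C_5}(G_n)$ over all sequences of graphs $G_n$ with $|V(G_n)|\to\infty$ and $|E(G_n)|/\binom{|V(G_n)|}{2}\to p$. -}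

module Defs where

open import Data.Bool using (Bool; true; false; _∧_; not; if_then_else_)
open import Data.Nat as ℕ using (ℕ; zero; suc; _≤_)
open import Data.Nat.Combinatorics using (_C_)
open import Data.Fin using (Fin; toℕ)
open import Data.Fin.Properties using (_≟_)
open import Data.List using (List; map; allFin)
open import Data.Nat.ListAction using (sum)
open import Data.Integer using (+_)
open import Data.Rational using (ℚ; 0ℚ; 1ℚ; _/_; _+_; _-_; _*_; _<_; ∣_∣)
import Data.Rational as Q
open import Data.Product using (Σ; ∃; _×_; _,_)
open import Relation.Binary.PropositionalEquality using (_≡_)
open import Relation.Nullary.Decidable using (⌊_⌋)

record Graph (n : ℕ) : Set where
  field
    adj    : Fin n → Fin n → Bool
    sym    : ∀ i j → adj i j ≡ adj j i
    irrefl : ∀ i → adj i i ≡ false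
open Graph public

𝟙 : Bool → ℕ
𝟙 true  = 1
𝟙 false = 0

sumFin : (n : ℕ) → (Fin n → ℕ) → ℕ
sumFin n f = sum (map f (allFin n))

-- a / b as a rational (with the convention a / 0 = 0, never used for b = 0 below
-- in any essential way)
frac : ℕ → ℕ → ℚ
frac a zero    = 0ℚ
frac a (suc b) = (+ a) / suc b

numEdges : ∀ {n} → Graph n → ℕ
numEdges {n} G =
  sumFin n λ i → sumFin n λ j → 𝟙 ((toℕ i ℕ.<ᵇ toℕ j) ∧ adj G i j)

edgeDensity : ∀ {n} → Graph n → ℚ
edgeDensity {n} G = frac (numEdges G) (n C 2)

diff : ∀ {n} → Fin n → Fin n → Bool
diff a b = not ⌊ a ≟ b ⌋

isLabelledC5 : ∀ {n} → Graph n → (a b c d e : Fin n) → Bool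
isLabelledC5 G a b c d e =
  diff a b ∧ diff a c ∧ diff a d ∧ diff a e ∧ diff b c ∧ diff b d ∧ diff b e
  ∧ diff c d ∧ diff c e ∧ diff d e
  ∧ adj G a b ∧ adj G b c ∧ adj G c d ∧ adj G d e ∧ adj G e a

labelledC5 : ∀ {n} → Graph n → ℕ
labelledC5 {n} G =
  sumFin n λ a → sumFin n λ b → sumFin n λ c → sumFin n λ d → sumFin n λ e →
  𝟙 (isLabelledC5 G a b c d e)

-- ν_{C5}(G): number of subgraphs of G isomorphic to C5
-- = (number of labelled copies) / |Aut(C5)|, and |Aut(C5)| = 10
νC5 : ∀ {n} → Graph n → ℕ
νC5 G = labelledC5 G ℕ./ 10

dC5 : ∀ {n} → Graph n → ℚ
dC5 {n} G = frac (νC5 G) (n ℕ.^ 5)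

C5LowerBound : ℚ → ℚ → Set
C5LowerBound p λ′ =
  ∀ (ε : ℚ) → 0ℚ < ε →
  Σ ℚ λ δ → 0ℚ < δ × Σ ℕ λ N →
    ∀ (n : ℕ) → N ≤ n → (G : Graph n) →
    ∣ edgeDensity G - p ∣ < δ → (λ′ - ε) Q.≤ dC5 G

C5UpperBound : ℚ → ℚ → Set
C5UpperBound p λ′ =
  ∀ (ε δ : ℚ) (N : ℕ) → 0ℚ < ε → 0ℚ < δ →
  Σ ℕ λ n → N ≤ n × Σ (Graph n) λ G →
    ∣ edgeDensity G - p ∣ < δ × dC5 G Q.≤ (λ′ + ε)

-- d_{C5}(p) = λ  (the limit definition unfolded into ε–δ form)
C5MinDensityIs : ℚ → ℚ → Set
C5MinDensityIs p λ′ = C5LowerBound p λ′ × C5UpperBound p λ′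

inv : ℕ → ℚ
inv m = frac 1 m

pk : ℕ → ℚ
pk k = 1ℚ - inv k

λk : ℕ → ℚ
λk k = frac 1 10 - frac 1 (2 ℕ.* k) + inv (k ℕ.^ 2) - inv (k ℕ.^ 3)
       + frac 2 (5 ℕ.* k ℕ.^ 4)

{-# OPTIONS --safe #-}

-- Let B = J − A be the indicator of the non-edges (diagonal included), normalised to act by
-- averages, let q be its density, d = B1 and w = Bd.  Expanding the product over the five edges,
--   t(C₅, A) = 1 − 5q + 5q² + 5(1−q)|d|² − 5⟨d,w⟩ + 5|w|² − t(C₅, B),
-- and t(C₅, B) ≤ t(P₅, B) = |w|² since deleting an edge only helps.  Writing d = q + f with f ⊥ 1,
-- the resulting lower bound is g(q) + Q, where g(q) = 1 − 5q + 10q² − 10q³ + 4q⁴ and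
--   Q = 4|Bf|² − (5−8q)⟨f,Bf⟩ + (5−15q+12q²)|f|²,
-- a quadratic in B with discriminant −5 − 2(8q−5)² < 0, so that Q ≥ 0.  Hence t(C₅, A) ≥ g(q)
-- for every graph, and g(1/k) = 10λ.  For the balanced complete k-partite graph f = 0 and
-- t(C₅, B) = t(P₅, B), so equality holds.
module Submission where

open import Defs renaming (sym to adj-sym)
open import Data.Bool using (Bool; true; false; _∧_; not)
open import Data.Bool.Properties using (not-involutive)
open import Data.Fin using (Fin; zero; suc; toℕ; _↑ˡ_; _↑ʳ_; combine; quotient)
open import Data.Fin.Properties using (_≟_; toℕ-injective; remQuot-combine)
open import Data.Integer as ℤ using (ℤ; +_; -[1+_]; 0ℤ; 1ℤ; -1ℤ; +≤+)
import Data.Integer.Properties as ℤₚ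
import Data.Integer.Tactic.RingSolver as ℤRing
open import Data.List using (List; []; _∷_; length; tabulate)
open import Data.List.Properties using (map-tabulate)
open import Data.List.Relation.Unary.All using (All; []; _∷_)
open import Data.Nat as ℕ using (ℕ; zero; suc; NonZero; z≤n; s≤s)
open import Data.Nat.Combinatorics using (_C_; nCk+nC[k+1]≡[n+1]C[k+1]; nC1≡n)
open import Data.Nat.DivMod using (m≡m%n+[m/n]*n; m%n<n; m/n*n≤m)
import Data.Nat.ListAction as ListAction
import Data.Nat.Properties as ℕₚ
import Data.Nat.Tactic.RingSolver as ℕRing
open import Data.Product using (Σ; _×_; _,_; proj₁; proj₂)
open import Data.Rational using (ℚ; 0ℚ; 1ℚ; mkℚ; _/_; Positive; positive; nonNegative; ∣_∣; toℚᵘ)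
import Data.Rational.Properties as ℚₚ
open import Data.Rational.Solver using (module +-*-Solver)
open import Data.Rational.Unnormalised as ℚᵘ using (mkℚᵘ; *≡*; *≤*)
import Data.Rational.Unnormalised.Properties as ℚᵘₚ
open import Data.Sum using (inj₁; inj₂)
open import Function using (_∘_; const; id)
open import Relation.Binary.Definitions using (tri<; tri≈; tri>)
open import Relation.Binary.PropositionalEquality using (_≡_; refl; sym; trans; cong; cong₂; subst; subst₂; module ≡-Reasoning)
open import Relation.Nullary using (¬_; yes; no; contradiction)
open import Relation.Nullary.Decidable using (⌊_⌋)

-- The polynomial g is dictated by the extremal graph: for q = 1/k the balanced complete k-partite
-- graph on N vertices has eigenvalue (1 - q)N once and -qN with multiplicity k - 1. Hence tr A⁵ /
-- N⁵ = (1 - q)⁵ - (1 - q)q⁴ = (1 - q)(1 - 2q)((1 - q)² + q²), and this factored form is the one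
-- carried through the code. Three discrepancies separate t(C₅, A) from the quantity in the
-- statement: closed walks may repeat vertices, `νC5` rounds a quotient by 10 down, and
-- `edgeDensity` normalises by pairs of distinct vertices while q counts the diagonal. Each costs
-- O(1/n) in the lower bound. In the upper bound the first two only decrease the count, so the
-- pentagon density of the extremal graph is at most λ with no error term. The graph counting is
-- done over the integers: d is scaled by N, w and q by N², and the final inequality by N⁸, so that
-- every identity is polynomial and division enters only with the densities.

module Counting where

  open import Algebra.Properties.Semiring.Sum ℤₚ.+-*-semiring using (sum-cong-≗; ∑-distrib-+; ∑-comm; *-distribˡ-sum; *-distribʳ-sum; sum-replicate-zero) renaming (sum to ∑)
  open import Data.Integer using (_+_; _*_; _-_; -_; _≤_)
  open ℤRing using (solve-∀)

  private variable
    n : ℕ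

  -- Finite integer sums and formal linear combinations

  ∑-const : ∀ n c → ∑ {n} (const c) ≡ + n * c
  ∑-const zero c = refl
  ∑-const (suc n) c = trans (cong (λ s → c + s) (∑-const n c)) (sym (ℤₚ.suc-* (+ n) c))

  ∑-mono : {f g : Fin n → ℤ} → (∀ i → f i ≤ g i) → ∑ f ≤ ∑ g
  ∑-mono {zero} h = ℤₚ.≤-refl
  ∑-mono {suc n} h = ℤₚ.+-mono-≤ (h zero) (∑-mono (h ∘ suc))

  ∑-nonneg : {f : Fin n → ℤ} → (∀ i → 0ℤ ≤ f i) → 0ℤ ≤ ∑ f
  ∑-nonneg {n} h = ℤₚ.≤-trans (ℤₚ.≤-reflexive (sym (sum-replicate-zero n))) (∑-mono h)

  *-nonneg : ∀ x y → 0ℤ ≤ x → 0ℤ ≤ y → 0ℤ ≤ x * y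
  *-nonneg (+ a) (+ b) _ _ = ℤₚ.≤-trans (+≤+ z≤n) (ℤₚ.≤-reflexive (ℤₚ.pos-* a b))

  square-nonneg : ∀ x → 0ℤ ≤ x * x
  square-nonneg (+ n)    = *-nonneg (+ n) (+ n) (+≤+ z≤n) (+≤+ z≤n)
  square-nonneg -[1+ n ] = +≤+ z≤n

  -- Coefficients and functions are kept as data so that one ring identity at a single index becomes
  -- an identity between sums or between matrix images. The closing `0ℤ` is the source of the
  -- trailing `+ 0ℤ` in the ring identities.
  lincomb : List (ℤ × (Fin n → ℤ)) → Fin n → ℤ
  lincomb []             i = 0ℤ
  lincomb ((c , f) ∷ ts) i = c * f i + lincomb ts i

  linmap : ((Fin n → ℤ) → ℤ) → List (ℤ × (Fin n → ℤ)) → ℤ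
  linmap φ []             = 0ℤ
  linmap φ ((c , f) ∷ ts) = c * φ f + linmap φ ts

  ∑-lincomb : (ts : List (ℤ × (Fin n → ℤ))) → ∑ (lincomb ts) ≡ linmap ∑ ts
  ∑-lincomb {n} []         = sum-replicate-zero n
  ∑-lincomb ((c , f) ∷ ts) = trans (∑-distrib-+ (λ i → c * f i) (lincomb ts))
    (cong₂ _+_ (sym (*-distribˡ-sum c f)) (∑-lincomb ts))

  ∑-as-lincomb : (f : Fin n → ℤ) (ts : List (ℤ × (Fin n → ℤ))) → (∀ i → f i ≡ lincomb ts i) → ∑ f ≡ linmap ∑ ts
  ∑-as-lincomb f ts h = trans (sum-cong-≗ h) (∑-lincomb ts)

  -- Integer matrices acting on vectors

  Matrix : ℕ → Set
  Matrix n = Fin n → Fin n → ℤ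

  infixr 7 _·_
  _·_ : Matrix n → (Fin n → ℤ) → Fin n → ℤ
  (M · v) i = ∑ λ j → M i j * v j

  ·-cong : (M : Matrix n) {u v : Fin n → ℤ} → (∀ j → u j ≡ v j) → ∀ i → (M · u) i ≡ (M · v) i
  ·-cong M h i = sum-cong-≗ λ j → cong (M i j *_) (h j)

  ·-lincomb : (M : Matrix n) (ts : List (ℤ × (Fin n → ℤ))) → ∀ i → (M · lincomb ts) i ≡ linmap (λ v → (M · v) i) ts
  ·-lincomb {n} M []         i = trans (sum-cong-≗ λ j → ℤₚ.*-zeroʳ (M i j)) (sum-replicate-zero n)
  ·-lincomb M ((c , f) ∷ ts) i = begin
    ∑ (λ j → M i j * (c * f j + lincomb ts j))              ≡⟨ sum-cong-≗ (λ j → expand (M i j) c (f j) (lincomb ts j)) ⟩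
    ∑ (λ j → c * (M i j * f j) + M i j * lincomb ts j)      ≡⟨ ∑-distrib-+ (λ j → c * (M i j * f j)) _ ⟩
    ∑ (λ j → c * (M i j * f j)) + (M · lincomb ts) i        ≡⟨ cong₂ _+_ (sym (*-distribˡ-sum c (λ j → M i j * f j))) (·-lincomb M ts i) ⟩
    c * (M · f) i + linmap (λ v → (M · v) i) ts             ∎
    where
    open ≡-Reasoning
    expand : ∀ a c x y → a * (c * x + y) ≡ c * (a * x) + a * y
    expand = solve-∀

  ·-as-lincomb : (M : Matrix n) {v : Fin n → ℤ} (ts : List (ℤ × (Fin n → ℤ))) → (∀ i → v i ≡ lincomb ts i) →
    ∀ i → (M · v) i ≡ linmap (λ u → (M · u) i) ts
  ·-as-lincomb M ts h i = trans (·-cong M h i) (·-lincomb M ts i)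

  Symmetric : Matrix n → Set
  Symmetric M = ∀ i j → M i j ≡ M j i

  ·-selfAdjoint : (M : Matrix n) → Symmetric M → ∀ u v → ∑ (λ i → u i * (M · v) i) ≡ ∑ (λ i → (M · u) i * v i)
  ·-selfAdjoint M M-sym u v = begin
    ∑ (λ i → u i * ∑ λ j → M i j * v j)    ≡⟨ sum-cong-≗ (λ i → *-distribˡ-sum (u i) (λ j → M i j * v j)) ⟩
    ∑ (λ i → ∑ λ j → u i * (M i j * v j))  ≡⟨ ∑-comm (λ i j → u i * (M i j * v j)) ⟩
    ∑ (λ j → ∑ λ i → u i * (M i j * v j))  ≡⟨ sum-cong-≗ (λ j → sum-cong-≗ λ i → trans (cong (λ a → u i * (a * v j)) (M-sym i j)) (shuffle (u i) (M j i) (v j))) ⟩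
    ∑ (λ j → ∑ λ i → (M j i * u i) * v j)  ≡⟨ sum-cong-≗ (λ j → sym (*-distribʳ-sum (v j) (λ i → M j i * u i))) ⟩
    ∑ (λ j → (M · u) j * v j)              ∎
    where
    open ≡-Reasoning
    shuffle : ∀ x a y → x * (a * y) ≡ (a * x) * y
    shuffle = solve-∀

  -- Closed walks of length five in a complement

  one : Fin n → ℤ
  one = const 1ℤ

  -- The diagonal entry at `a` of the fifth power of `M`, obtained by applying `M` four times to its
  -- column `a`. Its sum over `a` is the trace, reached without ever forming a matrix product.
  closed5Walks : Matrix n → Fin n → ℤ
  closed5Walks M a = (M · M · M · M · λ e → M e a) a

  complement : Matrix n → Matrix n
  complement B i j = 1ℤ - B i j

  -- N⁸ g(m / N²)
  c5Form : ℤ → ℤ → ℤ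
  c5Form N m = (N * N - m) * (N * N - m - m) * ((N * N - m) * (N * N - m) + m * m)

  module ComplementExpansion {n : ℕ} (B : Matrix n) (B-sym : Symmetric B) where

    N : ℤ
    N = + n

    d w u z : Fin n → ℤ
    d = B · one
    w = B · d
    u = B · w
    z = B · u

    -- These are ⟨1, Bʲ1⟩ for j = 1, 2, 3, 4, with the powers split by self-adjointness; the
    -- subscript counts the vertices of the path, not its edges.
    m p₃ p₄ p₅ : ℤ
    m  = ∑ d
    p₃ = ∑ λ i → d i * d i
    p₄ = ∑ λ i → d i * w i
    p₅ = ∑ λ i → w i * w i

    ∑-· : ∀ v → ∑ (B · v) ≡ ∑ λ i → d i * v i
    ∑-· v = trans (sum-cong-≗ λ i → sym (ℤₚ.*-identityˡ ((B · v) i))) (·-selfAdjoint B B-sym one v)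

    ∑w : ∑ w ≡ p₃
    ∑w = ∑-· d

    ∑u : ∑ u ≡ p₄
    ∑u = ∑-· w

    ∑du : ∑ (λ i → d i * u i) ≡ p₅
    ∑du = ·-selfAdjoint B B-sym d w

    ∑z : ∑ z ≡ p₅
    ∑z = trans (∑-· u) ∑du

    ∑-one : ∑ {n} one ≡ N
    ∑-one = trans (∑-const n 1ℤ) (ℤₚ.*-identityʳ N)

    private
      A : Matrix n
      A = complement B

    A· : ∀ v i → (A · v) i ≡ ∑ v - (B · v) i
    A· v i = begin
      ∑ (λ j → (1ℤ - B i j) * v j)   ≡⟨ ∑-as-lincomb _ ((1ℤ , v) ∷ (-1ℤ , λ j → B i j * v j) ∷ []) (λ j → expand (B i j) (v j)) ⟩
      1ℤ * ∑ v + (-1ℤ * (B · v) i + 0ℤ) ≡⟨ collect (∑ v) ((B · v) i) ⟩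
      ∑ v - (B · v) i ∎
      where
      open ≡-Reasoning
      expand : ∀ b x → (1ℤ - b) * x ≡ 1ℤ * x + (-1ℤ * (b * x) + 0ℤ)
      expand = solve-∀
      collect : ∀ x y → 1ℤ * x + (-1ℤ * y + 0ℤ) ≡ x - y
      collect = solve-∀

    module _ (a : Fin n) where

      b₀ b₁ b₂ b₃ : Fin n → ℤ
      b₀ e = B e a
      b₁ = B · b₀
      b₂ = B · b₁
      b₃ = B · b₂

      α β : ℤ
      α = N - d a
      β = α * N - m + w a

      ∑b₀ : ∑ b₀ ≡ d a
      ∑b₀ = sum-cong-≗ λ e → trans (B-sym e a) (sym (ℤₚ.*-identityʳ (B a e)))

      ∑-pull : ∀ v → ∑ (λ i → v i * b₀ i) ≡ (B · v) a
      ∑-pull v = sum-cong-≗ λ i → trans (ℤₚ.*-comm (v i) (B i a)) (cong (_* v i) (B-sym i a))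

      ∑b₁ : ∑ b₁ ≡ w a
      ∑b₁ = trans (∑-· b₀) (∑-pull d)

      ∑b₂ : ∑ b₂ ≡ u a
      ∑b₂ = trans (∑-· b₁) (trans (·-selfAdjoint B B-sym d b₀) (∑-pull w))

      ∑b₃ : ∑ b₃ ≡ z a
      ∑b₃ = trans (∑-· b₂) (trans (·-selfAdjoint B B-sym d b₁) (trans (·-selfAdjoint B B-sym w b₀) (∑-pull u)))

      v₀ v₁ v₂ v₃ : Fin n → ℤ
      v₀ e = A e a
      v₁ = A · v₀
      v₂ = A · v₁
      v₃ = A · v₂

      -- Because A v = (∑ v)·1 - B v, each application of A puts the coordinate sum of the previous
      -- vector on `one` and moves every older term one power of B further with its sign reversed.
      -- Thus `α` and `β` are the coordinate sums of `v₀` and `v₁`.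
      t₀ t₁ t₂ t₃ : List (ℤ × (Fin n → ℤ))
      t₀ = (1ℤ , one) ∷ (-1ℤ , b₀) ∷ []
      t₁ = (α , one) ∷ (-1ℤ , d) ∷ (1ℤ , b₁) ∷ []
      t₂ = (β , one) ∷ (- α , d) ∷ (1ℤ , w) ∷ (-1ℤ , b₂) ∷ []
      t₃ = (β * N - α * m + p₃ - u a , one) ∷ (- β , d) ∷ (α , w) ∷ (-1ℤ , u) ∷ (1ℤ , b₃) ∷ []

      private
        step : ∀ {v} ts → (∀ i → v i ≡ lincomb ts i) → ∀ i → (A · v) i ≡ linmap (λ f → ∑ f - (B · f) i) ts
        step ts h i = trans (·-as-lincomb A ts h i) (linmap-cong ts)
          where
          linmap-cong : ∀ ts → linmap (λ f → (A · f) i) ts ≡ linmap (λ f → ∑ f - (B · f) i) ts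
          linmap-cong []             = refl
          linmap-cong ((c , f) ∷ ts) = cong₂ _+_ (cong (c *_) (A· f i)) (linmap-cong ts)

      v₀-expand : ∀ i → v₀ i ≡ lincomb t₀ i
      v₀-expand i = ring (B i a)
        where
        ring : ∀ b → 1ℤ - b ≡ 1ℤ * 1ℤ + (-1ℤ * b + 0ℤ)
        ring = solve-∀

      v₁-expand : ∀ i → v₁ i ≡ lincomb t₁ i
      v₁-expand i = trans (step t₀ v₀-expand i) eq
        where
        ring : ∀ N da di b1 → 1ℤ * (N - di) + (-1ℤ * (da - b1) + 0ℤ) ≡ (N - da) * 1ℤ + (-1ℤ * di + (1ℤ * b1 + 0ℤ))
        ring = solve-∀
        eq : linmap (λ f → ∑ f - (B · f) i) t₀ ≡ lincomb t₁ i
        eq rewrite ∑-one | ∑b₀ = ring N (d a) (d i) (b₁ i)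

      v₂-expand : ∀ i → v₂ i ≡ lincomb t₂ i
      v₂-expand i = trans (step t₁ v₁-expand i) eq
        where
        ring : ∀ N m α wa di wi b2 → α * (N - di) + (-1ℤ * (m - wi) + (1ℤ * (wa - b2) + 0ℤ))
             ≡ (α * N - m + wa) * 1ℤ + (- α * di + (1ℤ * wi + (-1ℤ * b2 + 0ℤ)))
        ring = solve-∀
        eq : linmap (λ f → ∑ f - (B · f) i) t₁ ≡ lincomb t₂ i
        eq rewrite ∑-one | ∑b₁ = ring N m α (w a) (d i) (w i) (b₂ i)

      v₃-expand : ∀ i → v₃ i ≡ lincomb t₃ i
      v₃-expand i = trans (step t₂ v₂-expand i) eq
        where
        ring : ∀ N m p₃ α β ua di wi ui b3 →
               β * (N - di) + (- α * (m - wi) + (1ℤ * (p₃ - ui) + (-1ℤ * (ua - b3) + 0ℤ)))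
             ≡ (β * N - α * m + p₃ - ua) * 1ℤ + (- β * di + (α * wi + (-1ℤ * ui + (1ℤ * b3 + 0ℤ))))
        ring = solve-∀
        eq : linmap (λ f → ∑ f - (B · f) i) t₂ ≡ lincomb t₃ i
        eq rewrite ∑-one | ∑w | ∑b₂ = ring N m p₃ α β (u a) (d i) (w i) (u i) (b₃ i)

      closed5Walks-expand : closed5Walks A a ≡
        (β * N - α * m + p₃ - u a) * (N - d a) + (- β * (m - w a) + (α * (p₃ - u a) + (-1ℤ * (p₄ - z a) + (1ℤ * (z a - closed5Walks B a) + 0ℤ))))
      closed5Walks-expand = trans (step t₃ v₃-expand a) eq
        where
        eq : linmap (λ f → ∑ f - (B · f) a) t₃ ≡
          (β * N - α * m + p₃ - u a) * (N - d a) + (- β * (m - w a) + (α * (p₃ - u a) + (-1ℤ * (p₄ - z a) + (1ℤ * (z a - closed5Walks B a) + 0ℤ))))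
        eq rewrite ∑-one | ∑w | ∑u | ∑b₃ = refl

    -- The coefficients count edge subsets of the pentagon: two edges are adjacent (`p₃`) or
    -- disjoint (`m * m`) in five ways each, three edges form a path (`p₄`) or a path plus an edge
    -- (`m * p₃`) in five ways each, and four edges always form a path (`p₅`).
    closed5Walks-complement : ∑ (closed5Walks A) ≡
      N * N * N * N * N - + 5 * N * N * N * m + + 5 * N * N * p₃ + + 5 * N * m * m
      - + 5 * N * p₄ - + 5 * m * p₃ + + 5 * p₅ - ∑ (closed5Walks B)
    closed5Walks-complement = trans
      (∑-as-lincomb (closed5Walks A) terms (λ a → trans (closed5Walks-expand a) (expand N m p₃ p₄ (d a) (w a) (u a) (z a) (closed5Walks B a))))
      total
      where
      terms : List (ℤ × (Fin n → ℤ))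
      -- Grouped by monomials in `d`, `w`, `u`, `z` at `a`: after summation self-adjointness reduces
      -- each of them to `N`, `m` or one of the path counts, apart from the walks of B itself.
      terms = (N * N * N * N - + 3 * N * N * m + + 2 * N * p₃ + m * m - p₄ , one)
            ∷ (- (+ 2 * N * N * N) + + 4 * N * m - + 2 * p₃ , d)
            ∷ (+ 2 * N * N - + 2 * m , w)
            ∷ (- (+ 2 * N) , u)
            ∷ (+ 2 , z)
            ∷ (-1ℤ , closed5Walks B)
            ∷ (N * N - m , (λ i → d i * d i))
            ∷ (- (+ 2 * N) , (λ i → d i * w i))
            ∷ (+ 2 , (λ i → d i * u i))
            ∷ (1ℤ , (λ i → w i * w i))
            ∷ []
      expand : ∀ N m p₃ p₄ d w u z c →
        let α = N - d ; β = α * N - m + w in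
        (β * N - α * m + p₃ - u) * (N - d) + (- β * (m - w) + (α * (p₃ - u) + (-1ℤ * (p₄ - z) + (1ℤ * (z - c) + 0ℤ))))
        ≡ (N * N * N * N - + 3 * N * N * m + + 2 * N * p₃ + m * m - p₄) * 1ℤ
          + ((- (+ 2 * N * N * N) + + 4 * N * m - + 2 * p₃) * d
          + ((+ 2 * N * N - + 2 * m) * w
          + (- (+ 2 * N) * u
          + (+ 2 * z
          + (-1ℤ * c
          + ((N * N - m) * (d * d)
          + (- (+ 2 * N) * (d * w)
          + (+ 2 * (d * u)
          + (1ℤ * (w * w) + 0ℤ)))))))))
      expand = solve-∀
      total : linmap ∑ terms ≡
        N * N * N * N * N - + 5 * N * N * N * m + + 5 * N * N * p₃ + + 5 * N * m * m
        - + 5 * N * p₄ - + 5 * m * p₃ + + 5 * p₅ - ∑ (closed5Walks B)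
      total rewrite ∑-one | ∑w | ∑u | ∑z | ∑du = collect N m p₃ p₄ p₅ (∑ (closed5Walks B))
        where
        collect : ∀ N m p₃ p₄ p₅ c →
          (N * N * N * N - + 3 * N * N * m + + 2 * N * p₃ + m * m - p₄) * N
            + ((- (+ 2 * N * N * N) + + 4 * N * m - + 2 * p₃) * m
            + ((+ 2 * N * N - + 2 * m) * p₃
            + (- (+ 2 * N) * p₄
            + (+ 2 * p₅
            + (-1ℤ * c
            + ((N * N - m) * p₃
            + (- (+ 2 * N) * p₄
            + (+ 2 * p₅
            + (1ℤ * p₅ + 0ℤ)))))))))
          ≡ N * N * N * N * N - + 5 * N * N * N * m + + 5 * N * N * p₃ + + 5 * N * m * m
            - + 5 * N * p₄ - + 5 * m * p₃ + + 5 * p₅ - c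
        collect = solve-∀

    -- This is Q ≥ 0 multiplied by N⁸: the left side is the value that the right side would have if
    -- d were constant with the same mean.
    path-inequality : .{{_ : NonZero n}} →
      + 5 * m * m * N * N * N * N - + 10 * m * m * m * N * N + + 4 * m * m * m * m
      ≤ N * N * N * (+ 5 * N * N * p₃ - + 5 * N * p₄ - + 5 * m * p₃ + + 4 * p₅)
    path-inequality = ℤₚ.0≤i-j⇒j≤i (cancel n (ℤₚ.≤-trans ∑squares≥0 (ℤₚ.≤-reflexive ∑squares)))
      where
      E K : ℤ
      -- In normalised terms `E` is N²(5 - 8q) and `K` is N⁴ times minus the discriminant of Q,
      -- which makes its nonnegativity visible.
      E = + 5 * N * N - + 8 * m
      K = + 2 * (E * E) + + 5 * ((N * N) * (N * N))
      s r : Fin n → ℤ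
      -- `s` is N⁴(8Bf - (5 - 8q)f) and `r` is N²f. With f = d - q and Bf = w - qd the terms in qd
      -- cancel, which leaves the constant `E * m`.
      s i = + 8 * N * N * w i - + 5 * N * N * N * d i + E * m
      r i = N * d i - m
      -- 16 N⁸ times the summands of the header's form Q, with the square completed.
      squares : Fin n → ℤ
      squares i = s i * s i + K * (r i * r i)
      squares≥0 : ∀ i → 0ℤ ≤ squares i
      squares≥0 i = ℤₚ.+-mono-≤ (square-nonneg (s i)) (*-nonneg K (r i * r i) K≥0 (square-nonneg (r i)))
        where
        K≥0 : 0ℤ ≤ K
        K≥0 = ℤₚ.+-mono-≤ (*-nonneg (+ 2) (E * E) (+≤+ z≤n) (square-nonneg E))
          (*-nonneg (+ 5) ((N * N) * (N * N)) (+≤+ z≤n) (square-nonneg (N * N)))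
      terms : List (ℤ × (Fin n → ℤ))
      terms = (E * E * m * m + K * m * m , one)
            ∷ (- (+ 10 * N * N * N * E * m) - + 2 * K * N * m , d)
            ∷ (+ 16 * N * N * E * m , w)
            ∷ (+ 25 * N * N * N * N * N * N + K * N * N , (λ i → d i * d i))
            ∷ (- (+ 80 * N * N * N * N * N) , (λ i → d i * w i))
            ∷ (+ 64 * N * N * N * N , (λ i → w i * w i))
            ∷ []
      expand : ∀ N m E K d w →
          (+ 8 * N * N * w - + 5 * N * N * N * d + E * m) * (+ 8 * N * N * w - + 5 * N * N * N * d + E * m)
          + K * ((N * d - m) * (N * d - m))
        ≡ (E * E * m * m + K * m * m) * 1ℤ
          + ((- (+ 10 * N * N * N * E * m) - + 2 * K * N * m) * d
          + (+ 16 * N * N * E * m * w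
          + ((+ 25 * N * N * N * N * N * N + K * N * N) * (d * d)
          + (- (+ 80 * N * N * N * N * N) * (d * w)
          + (+ 64 * N * N * N * N * (w * w) + 0ℤ)))))
      expand = solve-∀
      collect : ∀ N m p₃ p₄ p₅ → let E = + 5 * N * N - + 8 * m ; K = + 2 * (E * E) + + 5 * ((N * N) * (N * N)) in
          (E * E * m * m + K * m * m) * N
          + ((- (+ 10 * N * N * N * E * m) - + 2 * K * N * m) * m
          + (+ 16 * N * N * E * m * p₃
          + ((+ 25 * N * N * N * N * N * N + K * N * N) * p₃
          + (- (+ 80 * N * N * N * N * N) * p₄
          + (+ 64 * N * N * N * N * p₅ + 0ℤ)))))
        ≡ + 16 * N * (N * N * N * (+ 5 * N * N * p₃ - + 5 * N * p₄ - + 5 * m * p₃ + + 4 * p₅)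
          - (+ 5 * m * m * N * N * N * N - + 10 * m * m * m * N * N + + 4 * m * m * m * m))
      collect = solve-∀

      -- The factor 16 comes from completing a square with leading coefficient 4, the factor N from
      -- summing instead of averaging.
      ∑squares : ∑ squares ≡ + 16 * N * (N * N * N * (+ 5 * N * N * p₃ - + 5 * N * p₄ - + 5 * m * p₃ + + 4 * p₅)
          - (+ 5 * m * m * N * N * N * N - + 10 * m * m * m * N * N + + 4 * m * m * m * m))
      ∑squares = trans (∑-as-lincomb squares terms λ i → expand N m E K (d i) (w i)) total
        where
        total : linmap ∑ terms ≡ _
        total rewrite ∑-one | ∑w = collect N m p₃ p₄ p₅
      ∑squares≥0 : 0ℤ ≤ ∑ squares
      ∑squares≥0 = ∑-nonneg squares≥0
      cancel : ∀ n .{{_ : NonZero n}} {x} → 0ℤ ≤ + 16 * + n * x → 0ℤ ≤ x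
      cancel (suc k) {x} h = ℤₚ.*-cancelˡ-≤-pos 0ℤ x (+ 16 * + suc k) (ℤₚ.≤-trans (ℤₚ.≤-reflexive (ℤₚ.*-zeroʳ (+ 16 * + suc k))) h)

    module _ (B≥0 : ∀ i j → 0ℤ ≤ B i j) (B≤1 : ∀ i j → B i j ≤ 1ℤ) where

      ·-mono : {f g : Fin n → ℤ} → (∀ j → f j ≤ g j) → ∀ i → (B · f) i ≤ (B · g) i
      ·-mono h i = ∑-mono λ j → *-monoˡ (B≥0 i j) (h j)
        where
        *-monoˡ : ∀ {a x y} → 0ℤ ≤ a → x ≤ y → a * x ≤ a * y
        *-monoˡ {+ a} _ = ℤₚ.*-monoˡ-≤-nonNeg (+ a)

      closed5Walks≤paths : ∑ (closed5Walks B) ≤ p₅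
      closed5Walks≤paths = ℤₚ.≤-trans
        (∑-mono λ a → ·-mono (·-mono (·-mono (·-mono λ e → B≤1 e a))) a)
        (ℤₚ.≤-reflexive ∑z)

      -- Of the five copies of `p₅` in the expansion one pays for the closed walks of B, and the
      -- other four are those of `path-inequality`; the slack is the sum of the two slacks.
      closed5Walks-lower : .{{_ : NonZero n}} →
        c5Form N m ≤ N * N * N * ∑ (closed5Walks A)
      closed5Walks-lower = ℤₚ.0≤i-j⇒j≤i (ℤₚ.≤-trans
        (ℤₚ.+-mono-≤ (ℤₚ.i≤j⇒0≤j-i path-inequality)
          (*-nonneg (N * N * N) (p₅ - C) (*-nonneg (N * N) N (square-nonneg N) (+≤+ z≤n)) (ℤₚ.i≤j⇒0≤j-i closed5Walks≤paths)))
        (ℤₚ.≤-reflexive (trans (collect N m p₃ p₄ p₅ C) (cong (λ x → N * N * N * x - c5Form N m) (sym closed5Walks-complement)))))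
        where
        C : ℤ
        C = ∑ (closed5Walks B)
        collect : ∀ N m p₃ p₄ p₅ C →
            N * N * N * (+ 5 * N * N * p₃ - + 5 * N * p₄ - + 5 * m * p₃ + + 4 * p₅)
            - (+ 5 * m * m * N * N * N * N - + 10 * m * m * m * N * N + + 4 * m * m * m * m)
            + N * N * N * (p₅ - C)
          ≡ N * N * N * (N * N * N * N * N - + 5 * N * N * N * m + + 5 * N * N * p₃ + + 5 * N * m * m
              - + 5 * N * p₄ - + 5 * m * p₃ + + 5 * p₅ - C)
            - (N * N - m) * (N * N - m - m) * ((N * N - m) * (N * N - m) + m * m)
        collect = solve-∀

  -- Labelled pentagons versus closed walks

  infix 8 ι_
  ι_ : Bool → ℤ
  ι b = + 𝟙 b

  sumFin≡∑ : ∀ n (f : Fin n → ℕ) → + sumFin n f ≡ ∑ (λ i → + f i)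
  sumFin≡∑ n f = trans (cong (λ xs → + ListAction.sum xs) (map-tabulate id f)) (tabulated n f)
    where
    tabulated : ∀ n (f : Fin n → ℕ) → + ListAction.sum (tabulate f) ≡ ∑ (λ i → + f i)
    tabulated zero    f = refl
    tabulated (suc n) f = cong (λ s → + f zero + s) (tabulated n (f ∘ suc))

  ∑⁵ : (Fin n → Fin n → Fin n → Fin n → Fin n → ℤ) → ℤ
  ∑⁵ f = ∑ λ a → ∑ λ b → ∑ λ c → ∑ λ d → ∑ λ e → f a b c d e

  ∑⁵-mono : {f g : Fin n → Fin n → Fin n → Fin n → Fin n → ℤ} →
    (∀ a b c d e → f a b c d e ≤ g a b c d e) → ∑⁵ f ≤ ∑⁵ g
  ∑⁵-mono h = ∑-mono λ a → ∑-mono λ b → ∑-mono λ c → ∑-mono λ d → ∑-mono λ e → h a b c d e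

  ∑⁵-distrib-+ : (f g : Fin n → Fin n → Fin n → Fin n → Fin n → ℤ) →
    ∑⁵ (λ a b c d e → f a b c d e + g a b c d e) ≡ ∑⁵ f + ∑⁵ g
  ∑⁵-distrib-+ f g =
    push (λ a → push (λ b → push (λ c → push (λ d → ∑-distrib-+ (f a b c d) (g a b c d)))))
    where
    push : {h x y : Fin n → ℤ} → (∀ i → h i ≡ x i + y i) → ∑ h ≡ ∑ x + ∑ y
    push {x = x} {y} eq = trans (sum-cong-≗ eq) (∑-distrib-+ x y)

  sumFin⁵≡∑⁵ : (f : Fin n → Fin n → Fin n → Fin n → Fin n → ℕ) →
    + (sumFin n λ a → sumFin n λ b → sumFin n λ c → sumFin n λ d → sumFin n λ e → f a b c d e)
    ≡ ∑⁵ (λ a b c d e → + f a b c d e)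
  sumFin⁵≡∑⁵ {n} f =
    push λ a → push λ b → push λ c → push λ d → sumFin≡∑ n (f a b c d)
    where
    push : {h : Fin n → ℕ} {g : Fin n → ℤ} → (∀ i → + h i ≡ g i) → + sumFin n h ≡ ∑ g
    push {h} eq = trans (sumFin≡∑ n h) (sum-cong-≗ eq)

  same : Fin n → Fin n → Bool
  same x y = ⌊ x ≟ y ⌋

  ∑-same : (x : Fin n) → ∑ (λ y → ι same x y) ≡ 1ℤ
  ∑-same {suc n} zero    = cong (λ s → 1ℤ + s) (sum-replicate-zero n)
  ∑-same {suc n} (suc x) = trans (ℤₚ.+-identityˡ _) (trans (sum-cong-≗ λ y → cong ι_ (shift x y)) (∑-same x))
    where
    shift : (x y : Fin n) → same (suc x) (suc y) ≡ same x y
    shift x y with x ≟ y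
    ... | yes _ = refl
    ... | no  _ = refl

  ∑-pick : {x : Fin n} {f : Fin n → ℤ} (c : ℤ) → (∀ y → f y ≡ c * ι same x y) → ∑ f ≡ c
  ∑-pick {x = x} c h = trans (sum-cong-≗ h)
    (trans (sym (*-distribˡ-sum c (λ y → ι same x y))) (trans (cong (c *_) (∑-same x)) (ℤₚ.*-identityʳ c)))

  module Labelled {n : ℕ} (G : Graph n) where

    N : ℤ
    N = + n

    consts : {f : Fin n → ℤ} {c : ℤ} → (∀ i → f i ≡ c) → ∑ f ≡ N * c
    consts {c = c} h = trans (sum-cong-≗ h) (∑-const n c)

    Tuple : Set → Set
    Tuple X = Fin n → Fin n → Fin n → Fin n → Fin n → X

    walk : Tuple Bool
    walk a b c d e = adj G a b ∧ adj G b c ∧ adj G c d ∧ adj G d e ∧ adj G e a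

    walks : ℤ
    walks = ∑⁵ λ a b c d e → ι walk a b c d e

    noneOf : List (Tuple Bool) → Tuple Bool → Tuple Bool
    noneOf []       g a b c d e = g a b c d e
    noneOf (f ∷ fs) g a b c d e = not (f a b c d e) ∧ noneOf fs g a b c d e

    count : List (Tuple Bool) → Tuple ℤ
    count []       a b c d e = 0ℤ
    count (f ∷ fs) a b c d e = ι f a b c d e + count fs a b c d e

    -- The tests are peeled off one at a time: a tuple lost because `f` holds is paid for by the
    -- indicator of `f`.
    union-bound : ∀ fs g a b c d e → ι g a b c d e ≤ ι noneOf fs g a b c d e + count fs a b c d e
    union-bound []       g a b c d e = ℤₚ.≤-reflexive (sym (ℤₚ.+-identityʳ _))
    union-bound (f ∷ fs) g a b c d e = ℤₚ.≤-trans (union-bound fs g a b c d e)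
      (ℤₚ.≤-trans (ℤₚ.+-monoˡ-≤ (count fs a b c d e) (split (f a b c d e) (noneOf fs g a b c d e)))
        (ℤₚ.≤-reflexive (ℤₚ.+-assoc (ι noneOf (f ∷ fs) g a b c d e) (ι f a b c d e) (count fs a b c d e))))
      where
      split : ∀ p x → ι x ≤ ι (not p ∧ x) + ι p
      split true  true  = +≤+ (ℕ.s≤s z≤n)
      split true  false = +≤+ z≤n
      split false true  = +≤+ (ℕ.s≤s z≤n)
      split false false = +≤+ z≤n

    ∑⁵-count : ∀ {K} fs → All (λ f → ∑⁵ (λ a b c d e → ι f a b c d e) ≡ K) fs → ∑⁵ (count fs) ≡ + length fs * K
    ∑⁵-count {K} []       []       = trans (zeros λ a → zeros λ b → zeros λ c → zeros λ d → zeros λ e → refl) (sym (ℤₚ.*-zeroˡ K))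
      where
      zeros : {f : Fin n → ℤ} → (∀ i → f i ≡ 0ℤ) → ∑ f ≡ 0ℤ
      zeros h = trans (sum-cong-≗ h) (sum-replicate-zero n)
    ∑⁵-count {K} (f ∷ fs) (h ∷ hs) = trans (∑⁵-distrib-+ (λ a b c d e → ι f a b c d e) (count fs))
      (trans (cong₂ _+_ h (∑⁵-count fs hs)) (sym (ℤₚ.suc-* (+ length fs) K)))

    -- The order is that of the distinctness tests in `isLabelledC5`, so `noneOf coincidences walk`
    -- unfolds to it and `labelled-sum` holds by computation.
    coincidences : List (Tuple Bool)
    coincidences =
        (λ a b c d e → same a b) ∷ (λ a b c d e → same a c) ∷ (λ a b c d e → same a d) ∷ (λ a b c d e → same a e)
      ∷ (λ a b c d e → same b c) ∷ (λ a b c d e → same b d) ∷ (λ a b c d e → same b e)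
      ∷ (λ a b c d e → same c d) ∷ (λ a b c d e → same c e) ∷ (λ a b c d e → same d e) ∷ []

    N⁴ : ℤ
    N⁴ = N * (N * (N * N))

    -- Each coincidence determines the later of its two vertices and leaves four free. The helpers
    -- differ only in how many sums lie inside the determined one: `deep` has none, `pick₁` to
    -- `pick₃` have one to three.
    coincidence-counts : All (λ f → ∑⁵ (λ a b c d e → ι f a b c d e) ≡ N⁴) coincidences
    coincidence-counts =
        (consts λ a → pick₃ a)
      ∷ (consts λ a → consts λ b → pick₂ a)
      ∷ (consts λ a → consts λ b → consts λ c → pick₁ a)
      ∷ deep (λ a b c d → a)
      ∷ (consts λ a → consts λ b → pick₂ b)
      ∷ (consts λ a → consts λ b → consts λ c → pick₁ b)
      ∷ deep (λ a b c d → b)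
      ∷ (consts λ a → consts λ b → consts λ c → pick₁ c)
      ∷ deep (λ a b c d → c)
      ∷ deep (λ a b c d → d)
      ∷ []
      where
      pick₁ : ∀ x → ∑ {n} (λ y → ∑ {n} λ e → ι same x y) ≡ N
      pick₁ x = ∑-pick {x = x} N λ y → consts λ e → refl
      pick₂ : ∀ x → ∑ {n} (λ y → ∑ {n} λ d → ∑ {n} λ e → ι same x y) ≡ N * N
      pick₂ x = ∑-pick {x = x} (N * N) λ y → trans (consts λ d → consts λ e → refl) (sym (ℤₚ.*-assoc N N (ι same x y)))
      pick₃ : ∀ x → ∑ {n} (λ y → ∑ {n} λ c → ∑ {n} λ d → ∑ {n} λ e → ι same x y) ≡ N * (N * N)
      pick₃ x = ∑-pick {x = x} (N * (N * N)) λ y →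
        trans (consts λ c → consts λ d → consts λ e → refl) (assoc₃ N (ι same x y))
        where
        assoc₃ : ∀ N c → N * (N * (N * c)) ≡ N * (N * N) * c
        assoc₃ = solve-∀
      deep : (x : Fin n → Fin n → Fin n → Fin n → Fin n) → ∑⁵ (λ a b c d e → ι same (x a b c d) e) ≡ N⁴
      deep x = trans (consts λ a → consts λ b → consts λ c → consts λ d → ∑-same (x a b c d))
        (cong (λ y → N * (N * (N * y))) (ℤₚ.*-identityʳ N))

    labelled-sum : + labelledC5 G ≡ ∑⁵ (λ a b c d e → ι noneOf coincidences walk a b c d e)
    labelled-sum = sumFin⁵≡∑⁵ (λ a b c d e → 𝟙 (isLabelledC5 G a b c d e))

    walks≤labelled+ : walks ≤ + labelledC5 G + + 10 * N⁴
    walks≤labelled+ = ℤₚ.≤-trans (∑⁵-mono (union-bound coincidences walk))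
      (ℤₚ.≤-reflexive (trans (∑⁵-distrib-+ (λ a b c d e → ι noneOf coincidences walk a b c d e) (count coincidences))
        (cong₂ _+_ (sym labelled-sum) (∑⁵-count coincidences coincidence-counts))))

    labelled≤walks : + labelledC5 G ≤ walks
    labelled≤walks = ℤₚ.≤-trans (ℤₚ.≤-reflexive labelled-sum) (∑⁵-mono (noneOf≤ coincidences))
      where
      ∧≤ : ∀ p x → ι (p ∧ x) ≤ ι x
      ∧≤ true  x = ℤₚ.≤-refl
      ∧≤ false x = +≤+ z≤n
      noneOf≤ : ∀ fs a b c d e → ι noneOf fs walk a b c d e ≤ ι walk a b c d e
      noneOf≤ []       a b c d e = ℤₚ.≤-refl
      noneOf≤ (f ∷ fs) a b c d e = ℤₚ.≤-trans (∧≤ _ (noneOf fs walk a b c d e)) (noneOf≤ fs a b c d e)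

  -- A graph as its non-edge matrix: walks, edges and the integer bound

  closed5Walks-cong : {M M′ : Matrix n} → (∀ i j → M i j ≡ M′ i j) → ∀ a → closed5Walks M a ≡ closed5Walks M′ a
  closed5Walks-cong {M = M} {M′} h a = step (step (step (step λ e → h e a))) a
    where
    step : {u v : Fin _ → ℤ} → (∀ i → u i ≡ v i) → ∀ i → (M · u) i ≡ (M′ · v) i
    step eq i = sum-cong-≗ λ j → cong₂ _*_ (h i j) (eq j)

  ι-∧ : ∀ p q → ι (p ∧ q) ≡ ι p * ι q
  ι-∧ true  q = sym (ℤₚ.*-identityˡ (ι q))
  ι-∧ false q = refl

  -- The diagonal counts as non-edges.
  nonEdges : Graph n → Matrix n
  nonEdges G i j = ι not (adj G i j)

  nonEdges-sym : (G : Graph n) → Symmetric (nonEdges G)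
  nonEdges-sym G i j = cong (λ b → ι not b) (adj-sym G i j)

  nonEdges≥0 : (G : Graph n) → ∀ i j → 0ℤ ≤ nonEdges G i j
  nonEdges≥0 G i j = +≤+ z≤n

  nonEdges≤1 : (G : Graph n) → ∀ i j → nonEdges G i j ≤ 1ℤ
  nonEdges≤1 G i j with adj G i j
  ... | true  = +≤+ z≤n
  ... | false = ℤₚ.≤-refl

  module _ {n : ℕ} (G : Graph n) where
    open Labelled G
    open ComplementExpansion (nonEdges G) (nonEdges-sym G) using (m; closed5Walks-lower)

    -- The cyclic product lists its edges in the order of the iterated matrix action, so each
    -- adjacency factor can leave the inner sums, on whose indices it does not depend.
    walks≡closed5Walks : walks ≡ ∑ (closed5Walks (complement (nonEdges G)))
    walks≡closed5Walks = sum-cong-≗ λ a → trans (nested a) (sym (closed5Walks-cong (λ i j → complement-not (adj G i j)) a))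
      where
      complement-not : ∀ b → 1ℤ - ι not b ≡ ι b
      complement-not true  = refl
      complement-not false = refl
      pull₁ : ∀ p (q : Fin n → Bool) → ∑ (λ e → ι (p ∧ q e)) ≡ ι p * ∑ (λ e → ι q e)
      pull₁ p q = trans (sum-cong-≗ λ e → ι-∧ p (q e)) (sym (*-distribˡ-sum (ι p) (λ e → ι q e)))
      pull₂ : ∀ p (q : Fin n → Fin n → Bool) → ∑ (λ d → ∑ λ e → ι (p ∧ q d e)) ≡ ι p * ∑ (λ d → ∑ λ e → ι q d e)
      pull₂ p q = trans (sum-cong-≗ λ d → pull₁ p (q d)) (sym (*-distribˡ-sum (ι p) (λ d → ∑ λ e → ι q d e)))
      pull₃ : ∀ p (q : Fin n → Fin n → Fin n → Bool) →
        ∑ (λ c → ∑ λ d → ∑ λ e → ι (p ∧ q c d e)) ≡ ι p * ∑ (λ c → ∑ λ d → ∑ λ e → ι q c d e)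
      pull₃ p q = trans (sum-cong-≗ λ c → pull₂ p (q c)) (sym (*-distribˡ-sum (ι p) (λ c → ∑ λ d → ∑ λ e → ι q c d e)))
      nested : ∀ a → ∑ (λ b → ∑ λ c → ∑ λ d → ∑ λ e → ι walk a b c d e) ≡ closed5Walks (λ i j → ι adj G i j) a
      nested a = sum-cong-≗ λ b → trans (pull₃ (adj G a b) (λ c d e → adj G b c ∧ adj G c d ∧ adj G d e ∧ adj G e a))
        (cong (ι adj G a b *_) (sum-cong-≗ λ c → trans (pull₂ (adj G b c) (λ d e → adj G c d ∧ adj G d e ∧ adj G e a))
          (cong (ι adj G b c *_) (sum-cong-≗ λ d → trans (pull₁ (adj G c d) (λ e → adj G d e ∧ adj G e a))
            (cong (ι adj G c d *_) (sum-cong-≗ λ e → ι-∧ (adj G d e) (adj G e a)))))))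

    -- Handshake count: an ordered pair of distinct vertices is increasing in exactly one of its two
    -- orders, and irreflexivity removes the diagonal.
    ∑-adj : ∑ (λ i → ∑ λ j → ι adj G i j) ≡ + 2 * + numEdges G
    ∑-adj = begin
      ∑ (λ i → ∑ λ j → ι adj G i j)                                  ≡⟨ sum-cong-≗ (λ i → trans (sum-cong-≗ (split i)) (∑-distrib-+ (up i) (λ j → up j i))) ⟩
      ∑ (λ i → ∑ (up i) + ∑ λ j → up j i)                            ≡⟨ ∑-distrib-+ (λ i → ∑ (up i)) (λ i → ∑ λ j → up j i) ⟩
      ∑ (λ i → ∑ (up i)) + ∑ (λ i → ∑ λ j → up j i)                  ≡⟨ cong₂ _+_ edges (trans (∑-comm (λ i j → up j i)) edges) ⟩
      + numEdges G + + numEdges G                                    ≡⟨ double (+ numEdges G) ⟩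
      + 2 * + numEdges G                                             ∎
      where
      open ≡-Reasoning
      double : ∀ x → x + x ≡ + 2 * x
      double = solve-∀
      upℕ : Fin n → Fin n → ℕ
      upℕ i j = 𝟙 ((toℕ i ℕ.<ᵇ toℕ j) ∧ adj G i j)
      up : Fin n → Fin n → ℤ
      up i j = + upℕ i j
      edges : ∑ (λ i → ∑ (up i)) ≡ + numEdges G
      edges = sym (trans (sumFin≡∑ n (λ i → sumFin n (upℕ i))) (sum-cong-≗ λ i → sumFin≡∑ n (upℕ i)))
      <ᵇ-true : ∀ {x y} → x ℕ.< y → (x ℕ.<ᵇ y) ≡ true
      <ᵇ-true {x} {y} x<y with x ℕ.<ᵇ y | ℕₚ.<⇒<ᵇ x<y
      ... | true | _ = refl
      <ᵇ-false : ∀ {x y} → ¬ (x ℕ.< y) → (x ℕ.<ᵇ y) ≡ false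
      <ᵇ-false {x} {y} x≮y with x ℕ.<ᵇ y | ℕₚ.<ᵇ⇒< x y
      ... | true  | h = contradiction (h _) x≮y
      ... | false | _ = refl
      split : ∀ i j → ι adj G i j ≡ up i j + up j i
      split i j with ℕₚ.<-cmp (toℕ i) (toℕ j)
      ... | tri< i<j _ j≮i rewrite <ᵇ-true i<j | <ᵇ-false j≮i = sym (ℤₚ.+-identityʳ _)
      ... | tri> i≮j _ j<i rewrite <ᵇ-true j<i | <ᵇ-false i≮j = trans (cong ι_ (adj-sym G i j)) (sym (ℤₚ.+-identityˡ _))
      ... | tri≈ i≮j i≡j j≮i rewrite <ᵇ-false i≮j | <ᵇ-false j≮i | toℕ-injective i≡j | irrefl G j = refl

    m≡N²-2e : m ≡ N * N - + 2 * + numEdges G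
    m≡N²-2e = begin
      ∑ (λ i → ∑ λ j → nonEdges G i j * 1ℤ)            ≡⟨ sum-cong-≗ row ⟩
      ∑ (λ i → 1ℤ * N + (-1ℤ * ∑ (λ j → ι adj G i j) + 0ℤ)) ≡⟨ ∑-lincomb ((1ℤ , const N) ∷ (-1ℤ , λ i → ∑ λ j → ι adj G i j) ∷ []) ⟩
      1ℤ * ∑ {n} (const N) + (-1ℤ * ∑ (λ i → ∑ λ j → ι adj G i j) + 0ℤ) ≡⟨ cong₂ (λ x y → 1ℤ * x + (-1ℤ * y + 0ℤ)) (∑-const n N) ∑-adj ⟩
      1ℤ * (N * N) + (-1ℤ * (+ 2 * + numEdges G) + 0ℤ) ≡⟨ collect (N * N) (+ 2 * + numEdges G) ⟩
      N * N - + 2 * + numEdges G                       ∎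
      where
      open ≡-Reasoning
      collect : ∀ x y → 1ℤ * x + (-1ℤ * y + 0ℤ) ≡ x - y
      collect = solve-∀
      pointwise : ∀ b → ι not b * 1ℤ ≡ 1ℤ * 1ℤ + (-1ℤ * ι b + 0ℤ)
      pointwise true  = refl
      pointwise false = refl
      row : ∀ i → ∑ (λ j → nonEdges G i j * 1ℤ) ≡ 1ℤ * N + (-1ℤ * ∑ (λ j → ι adj G i j) + 0ℤ)
      row i = trans (∑-as-lincomb _ ((1ℤ , one) ∷ (-1ℤ , λ j → ι adj G i j) ∷ []) (λ j → pointwise (adj G i j)))
        (cong (λ x → 1ℤ * x + (-1ℤ * ∑ (λ j → ι adj G i j) + 0ℤ)) (trans (∑-const n 1ℤ) (ℤₚ.*-identityʳ N)))

    nonEdges-count≥0 : 0ℤ ≤ N * N - + 2 * + numEdges G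
    nonEdges-count≥0 = subst (0ℤ ≤_) m≡N²-2e (∑-nonneg λ i → ∑-nonneg λ j → *-nonneg (nonEdges G i j) 1ℤ (+≤+ z≤n) (+≤+ z≤n))

    N³-mono : ∀ {x y} → x ≤ y → N * N * N * x ≤ N * N * N * y
    N³-mono {x} {y} x≤y = ℤₚ.0≤i-j⇒j≤i (ℤₚ.≤-trans
      (*-nonneg (N * N * N) (y - x) (*-nonneg (N * N) N (square-nonneg N) (+≤+ z≤n)) (ℤₚ.i≤j⇒0≤j-i x≤y))
      (ℤₚ.≤-reflexive (distrib (N * N * N) x y)))
      where
      distrib : ∀ c x y → c * (y - x) ≡ c * y - c * x
      distrib = solve-∀

    labelled-lower : .{{_ : NonZero n}} → c5Form N (N * N - + 2 * + numEdges G) ≤ N * N * N * (+ labelledC5 G + + 10 * N⁴)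
    labelled-lower = subst (λ x → c5Form N x ≤ N * N * N * (+ labelledC5 G + + 10 * N⁴)) m≡N²-2e
      (ℤₚ.≤-trans (closed5Walks-lower (nonEdges≥0 G) (nonEdges≤1 G))
        (N³-mono (ℤₚ.≤-trans (ℤₚ.≤-reflexive (sym walks≡closed5Walks)) walks≤labelled+)))

  -- The balanced complete multipartite graph

  ∑-++ : ∀ m {n} (f : Fin (m ℕ.+ n) → ℤ) → ∑ f ≡ ∑ (λ i → f (i ↑ˡ n)) + ∑ (λ j → f (m ↑ʳ j))
  ∑-++ zero    f = sym (ℤₚ.+-identityˡ (∑ f))
  ∑-++ (suc m) f = trans (cong (λ s → f zero + s) (∑-++ m (f ∘ suc))) (sym (ℤₚ.+-assoc (f zero) _ _))

  ∑-combine : ∀ k t (f : Fin (k ℕ.* t) → ℤ) → ∑ f ≡ ∑ {k} λ a → ∑ {t} λ b → f (combine a b)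
  ∑-combine zero    t f = refl
  ∑-combine (suc k) t f = trans (∑-++ t f) (cong (λ s → ∑ (λ b → f (b ↑ˡ (k ℕ.* t))) + s) (∑-combine k t (f ∘ (t ↑ʳ_))))

  diff-sym : (x y : Fin n) → diff x y ≡ diff y x
  diff-sym x y with x ≟ y | y ≟ x
  ... | yes _   | yes _   = refl
  ... | no  _   | no  _   = refl
  ... | yes x≡y | no  y≢x = contradiction (sym x≡y) y≢x
  ... | no  x≢y | yes y≡x = contradiction (sym y≡x) x≢y

  diff-irrefl : (x : Fin n) → diff x x ≡ false
  diff-irrefl x with x ≟ x
  ... | yes _   = refl
  ... | no  x≢x = contradiction refl x≢x

  -- Transitivity of equality as a product rule, with `same x y` left as the last factor so that a
  -- later sum over the middle vertex is a row sum.
  same-transitive : (x y z : Fin n) → ι same x y * ι same y z ≡ ι same x z * ι same x y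
  same-transitive x y z with x ≟ y
  ... | yes refl = ℤₚ.*-comm 1ℤ (ι same x z)
  ... | no  _    = sym (ℤₚ.*-zeroʳ (ι same x z))

  -- All `k` parts have exactly `t` vertices, which makes the graph regular and `d` constant. Orders
  -- divisible by `k` suffice because `C5UpperBound` only asks for some order beyond each bound.
  turán : ∀ k t → Graph (k ℕ.* t)
  turán k t = record
    { adj    = λ i j → diff (quotient t i) (quotient t j)
    ; sym    = λ i j → diff-sym (quotient {k} t i) (quotient t j)
    ; irrefl = λ i → diff-irrefl (quotient {k} t i)
    }

  module Turán (k t : ℕ) where
    G : Graph (k ℕ.* t)
    G = turán k t

    N T : ℤ
    N = + (k ℕ.* t)
    T = + t

    B : Matrix (k ℕ.* t)
    B = nonEdges G

    part : Fin (k ℕ.* t) → Fin k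
    part = quotient t

    open ComplementExpansion B (nonEdges-sym G) using (d; w; m; p₃; p₄; p₅; closed5Walks-complement)

    B≡same : ∀ i j → B i j ≡ ι same (part i) (part j)
    B≡same i j = cong ι_ (not-involutive (same (part i) (part j)))

    ∑-row : ∀ i → ∑ (B i) ≡ T
    ∑-row i = trans (∑-combine k t (B i)) (∑-pick {x = part i} T λ a → trans (sum-cong-≗ {t} λ b → entry a b) (∑-const t (ι same (part i) a)))
      where
      entry : ∀ a b → B i (combine a b) ≡ ι same (part i) a
      entry a b = trans (B≡same i (combine a b)) (cong (λ x → ι same (part i) (proj₁ x)) (remQuot-combine a b))

    ·-const : ∀ {v c} → (∀ j → v j ≡ c) → ∀ i → (B · v) i ≡ T * c
    ·-const {v} {c} h i = trans (·-cong B h i) (trans (sym (*-distribʳ-sum c (B i))) (cong (_* c) (∑-row i)))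

    B-transitive : ∀ i e a → B i e * B e a ≡ B i a * B i e
    B-transitive i e a = trans (cong₂ _*_ (B≡same i e) (B≡same e a))
      (trans (same-transitive (part i) (part e) (part a)) (sym (cong₂ _*_ (B≡same i a) (B≡same i e))))

    -- The non-edges with the diagonal form an equivalence relation with classes of size `T`, so B²
    -- = T B; here this appears column by column.
    ·-column : ∀ {v} c a → (∀ j → v j ≡ c * B j a) → ∀ i → (B · v) i ≡ T * c * B i a
    ·-column {v} c a h i = trans (sum-cong-≗ λ j → trans (cong (B i j *_) (h j)) (regroup (B i j) c (B j a) (B i a) (B-transitive i j a)))
      (trans (sym (*-distribˡ-sum (c * B i a) (B i))) (trans (cong (c * B i a *_) (∑-row i)) (rotate c (B i a) T)))
      where
      swap : ∀ x c y → x * (c * y) ≡ c * (x * y)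
      swap = solve-∀
      regroup : ∀ x c y z → x * y ≡ z * x → x * (c * y) ≡ c * z * x
      regroup x c y z e = trans (swap x c y) (trans (cong (c *_) e) (sym (ℤₚ.*-assoc c z x)))
      rotate : ∀ c x T → c * x * T ≡ T * c * x
      rotate = solve-∀

    closed5Walks-B : ∀ a → closed5Walks B a ≡ T * (T * (T * (T * 1ℤ)))
    closed5Walks-B a = trans
      (·-column (T * (T * (T * 1ℤ))) a (·-column (T * (T * 1ℤ)) a (·-column (T * 1ℤ) a (·-column 1ℤ a λ e → sym (ℤₚ.*-identityˡ (B e a))))) a)
      (trans (cong (T * (T * (T * (T * 1ℤ))) *_) diagonal) (ℤₚ.*-identityʳ _))
      where
      diagonal : B a a ≡ 1ℤ
      diagonal = cong (λ b → ι not b) (irrefl G a)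

    d≡ : ∀ i → d i ≡ T * 1ℤ
    d≡ = ·-const λ _ → refl

    w≡ : ∀ i → w i ≡ T * (T * 1ℤ)
    w≡ = ·-const d≡

    ∑-uniform : ∀ {f : Fin (k ℕ.* t) → ℤ} {c} → (∀ i → f i ≡ c) → ∑ f ≡ N * c
    ∑-uniform {c = c} h = trans (sum-cong-≗ h) (∑-const (k ℕ.* t) c)

    m≡ : m ≡ N * (T * 1ℤ)
    m≡ = ∑-uniform d≡

    -- Discarding degenerate walks only lowers the count, and the walk count itself is exact: all
    -- sums in the expansion are of constants.
    labelled-upper : + labelledC5 G ≤
      N * ((N - T) * (N - T - T) * ((N - T) * (N - T) + T * T))
    labelled-upper = ℤₚ.≤-trans (Labelled.labelled≤walks G) (ℤₚ.≤-reflexive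
      (trans (walks≡closed5Walks G) (trans closed5Walks-complement (value m≡
        (∑-uniform λ i → cong₂ _*_ (d≡ i) (d≡ i)) (∑-uniform λ i → cong₂ _*_ (d≡ i) (w≡ i))
        (∑-uniform λ i → cong₂ _*_ (w≡ i) (w≡ i)) (∑-uniform closed5Walks-B)))))
      where
      collect : ∀ N T → let τ = T * 1ℤ ; τ² = T * τ in
          N * N * N * N * N - + 5 * N * N * N * (N * τ) + + 5 * N * N * (N * (τ * τ)) + + 5 * N * (N * τ) * (N * τ)
          - + 5 * N * (N * (τ * τ²)) - + 5 * (N * τ) * (N * (τ * τ)) + + 5 * (N * (τ² * τ²)) - N * (T * (T * (T * (T * 1ℤ))))
        ≡ N * ((N - T) * (N - T - T) * ((N - T) * (N - T) + T * T))
      collect = solve-∀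
      value : ∀ {m p₃ p₄ p₅ c} → m ≡ N * (T * 1ℤ) → p₃ ≡ N * (T * 1ℤ * (T * 1ℤ)) → p₄ ≡ N * (T * 1ℤ * (T * (T * 1ℤ))) →
        p₅ ≡ N * (T * (T * 1ℤ) * (T * (T * 1ℤ))) → c ≡ N * (T * (T * (T * (T * 1ℤ)))) →
          N * N * N * N * N - + 5 * N * N * N * m + + 5 * N * N * p₃ + + 5 * N * m * m
          - + 5 * N * p₄ - + 5 * m * p₃ + + 5 * p₅ - c
        ≡ N * ((N - T) * (N - T - T) * ((N - T) * (N - T) + T * T))
      value refl refl refl refl refl = collect N T

    numEdges-turán : + 2 * + numEdges G ≡ N * N - N * T
    numEdges-turán = trans (rearrange (N * N) (+ 2 * + numEdges G)) (cong (λ x → N * N - x)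
      (trans (sym (m≡N²-2e G)) (trans m≡ (cong (N *_) (ℤₚ.*-identityʳ T)))))
      where
      rearrange : ∀ x y → y ≡ x - (x - y)
      rearrange = solve-∀

module Densities where

  open import Data.Rational using (_+_; _*_; _-_; -_; _≤_; _<_)
  open +-*-Solver
  open Counting

  -- Transfer from integers to rationals, and the identity between λ and g

  R : ℤ → ℚ
  R z = z / 1

  toℚᵘ-R : ∀ z → toℚᵘ (R z) ℚᵘ.≃ mkℚᵘ z 0
  toℚᵘ-R z = ℚₚ.toℚᵘ-fromℚᵘ (mkℚᵘ z 0)

  R-+ : ∀ x y → R (x ℤ.+ y) ≡ R x + R y
  R-+ x y = ℚₚ.toℚᵘ-injective (begin
    toℚᵘ (R (x ℤ.+ y))          ≈⟨ toℚᵘ-R (x ℤ.+ y) ⟩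
    mkℚᵘ (x ℤ.+ y) 0            ≈⟨ *≡* (ring x y) ⟩
    mkℚᵘ x 0 ℚᵘ.+ mkℚᵘ y 0      ≈⟨ ℚᵘₚ.+-cong (toℚᵘ-R x) (toℚᵘ-R y) ⟨
    toℚᵘ (R x) ℚᵘ.+ toℚᵘ (R y)  ≈⟨ ℚₚ.toℚᵘ-homo-+ (R x) (R y) ⟨
    toℚᵘ (R x + R y)            ∎)
    where
    open ℚᵘₚ.≃-Reasoning
    ring : ∀ x y → (x ℤ.+ y) ℤ.* (+ 1) ≡ (x ℤ.* + 1 ℤ.+ y ℤ.* + 1) ℤ.* + 1
    ring = ℤRing.solve-∀

  R-* : ∀ x y → R (x ℤ.* y) ≡ R x * R y
  R-* x y = ℚₚ.toℚᵘ-injective (begin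
    toℚᵘ (R (x ℤ.* y))          ≈⟨ toℚᵘ-R (x ℤ.* y) ⟩
    mkℚᵘ (x ℤ.* y) 0            ≈⟨ *≡* refl ⟩
    mkℚᵘ x 0 ℚᵘ.* mkℚᵘ y 0      ≈⟨ ℚᵘₚ.*-cong (toℚᵘ-R x) (toℚᵘ-R y) ⟨
    toℚᵘ (R x) ℚᵘ.* toℚᵘ (R y)  ≈⟨ ℚₚ.toℚᵘ-homo-* (R x) (R y) ⟨
    toℚᵘ (R x * R y)            ∎)
    where
    open ℚᵘₚ.≃-Reasoning

  R-neg : ∀ x → R (ℤ.- x) ≡ - R x
  R-neg x = ℚₚ.toℚᵘ-injective (begin
    toℚᵘ (R (ℤ.- x))   ≈⟨ toℚᵘ-R (ℤ.- x) ⟩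
    ℚᵘ.- mkℚᵘ x 0      ≈⟨ ℚᵘₚ.-‿cong (toℚᵘ-R x) ⟨
    ℚᵘ.- toℚᵘ (R x)    ≈⟨ ℚₚ.toℚᵘ-homo‿- (R x) ⟨
    toℚᵘ (- R x)       ∎)
    where
    open ℚᵘₚ.≃-Reasoning

  R-- : ∀ x y → R (x ℤ.- y) ≡ R x - R y
  R-- x y = trans (R-+ x (ℤ.- y)) (cong (λ z → R x + z) (R-neg y))

  R-mono : ∀ {x y} → x ℤ.≤ y → R x ≤ R y
  R-mono {x} {y} x≤y = ℚₚ.toℚᵘ-cancel-≤ (ℚᵘₚ.≤-respʳ-≃ (ℚᵘₚ.≃-sym (toℚᵘ-R y)) (ℚᵘₚ.≤-respˡ-≃ (ℚᵘₚ.≃-sym (toℚᵘ-R x))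
    (*≤* (ℤₚ.*-monoʳ-≤-nonNeg (+ 1) x≤y))))

  frac-* : ∀ a b .{{_ : NonZero b}} → frac a b * R (+ b) ≡ R (+ a)
  frac-* a (suc b) = ℚₚ.toℚᵘ-injective (begin
    toℚᵘ (frac a (suc b) * R (+ suc b))             ≈⟨ ℚₚ.toℚᵘ-homo-* (frac a (suc b)) (R (+ suc b)) ⟩
    toℚᵘ (frac a (suc b)) ℚᵘ.* toℚᵘ (R (+ suc b))   ≈⟨ ℚᵘₚ.*-cong (ℚₚ.toℚᵘ-fromℚᵘ (mkℚᵘ (+ a) b)) (toℚᵘ-R (+ suc b)) ⟩
    mkℚᵘ (+ a) b ℚᵘ.* mkℚᵘ (+ suc b) 0              ≈⟨ *≡* (ring (+ a) (+ suc b)) ⟩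
    mkℚᵘ (+ a) 0                                    ≈⟨ toℚᵘ-R (+ a) ⟨
    toℚᵘ (R (+ a))                                  ∎)
    where
    open ℚᵘₚ.≃-Reasoning
    ring : ∀ a b → a ℤ.* b ℤ.* + 1 ≡ a ℤ.* (b ℤ.* + 1)
    ring = ℤRing.solve-∀

  frac-unique : ∀ a b .{{_ : NonZero b}} v → v * R (+ b) ≡ R (+ a) → frac a b ≡ v
  frac-unique a b v h = begin
    frac a b                       ≡⟨ ℚₚ.*-identityʳ (frac a b) ⟨
    frac a b * 1ℚ                  ≡⟨ cong (frac a b *_) inverse ⟨
    frac a b * (R (+ b) * inv b)   ≡⟨ ℚₚ.*-assoc (frac a b) (R (+ b)) (inv b) ⟨
    frac a b * R (+ b) * inv b     ≡⟨ cong (_* inv b) (trans (frac-* a b) (sym h)) ⟩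
    v * R (+ b) * inv b            ≡⟨ ℚₚ.*-assoc v (R (+ b)) (inv b) ⟩
    v * (R (+ b) * inv b)          ≡⟨ cong (v *_) inverse ⟩
    v * 1ℚ                         ≡⟨ ℚₚ.*-identityʳ v ⟩
    v                              ∎
    where
    open ≡-Reasoning
    inverse : R (+ b) * inv b ≡ 1ℚ
    inverse = trans (ℚₚ.*-comm (R (+ b)) (inv b)) (frac-* 1 b)

  g : ℚ → ℚ
  g x = (1ℚ - x) * ((1ℚ - x) - x) * ((1ℚ - x) * (1ℚ - x) + x * x)

  R-ℕ* : ∀ a b → R (+ (a ℕ.* b)) ≡ R (+ a) * R (+ b)
  R-ℕ* a b = trans (cong R (ℤₚ.pos-* a b)) (R-* (+ a) (+ b))

  -- `frac-unique` turns every fraction of `λk` into a multiple of a power of `inv k`; what remains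
  -- is a polynomial identity in one variable. The factor 10 is the number of labellings of a
  -- pentagon.
  10λ≡g : ∀ k .{{_ : NonZero k}} → R (+ 10) * λk k ≡ g (inv k)
  10λ≡g k@(suc _) = trans (cong (R (+ 10) *_) parts) (ring κ)
    where
    κ K : ℚ
    κ = inv k
    K = R (+ k)
    κK : κ * K ≡ 1ℚ
    κK = frac-* 1 k
    open +-*-Solver
    R-^ : ∀ j → R (+ (k ℕ.^ suc j)) ≡ K * R (+ (k ℕ.^ j))
    R-^ j = R-ℕ* k (k ℕ.^ j)
    inv-^ : ∀ j v → v * R (+ (k ℕ.^ j)) ≡ 1ℚ → κ * v * R (+ (k ℕ.^ suc j)) ≡ 1ℚ
    inv-^ j v h = trans (cong (κ * v *_) (R-^ j))
      (trans (solve 4 (λ κ v K P → κ :* v :* (K :* P) := κ :* K :* (v :* P)) refl κ v K (R (+ (k ℕ.^ j))))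
        (cong₂ _*_ κK h))
    κ² κ³ κ⁴ : ℚ
    κ² = κ * (κ * 1ℚ)
    κ³ = κ * κ²
    κ⁴ = κ * κ³
    h² : κ² * R (+ (k ℕ.^ 2)) ≡ 1ℚ
    h² = inv-^ 1 (κ * 1ℚ) (inv-^ 0 1ℚ refl)
    h³ : κ³ * R (+ (k ℕ.^ 3)) ≡ 1ℚ
    h³ = inv-^ 2 κ² h²
    h⁴ : κ⁴ * R (+ (k ℕ.^ 4)) ≡ 1ℚ
    h⁴ = inv-^ 3 κ³ h³
    scaled : ∀ a b c v → .{{_ : NonZero (b ℕ.* c)}} → v * R (+ c) ≡ 1ℚ → (r : ℚ) → r * R (+ b) ≡ R (+ a) → frac a (b ℕ.* c) ≡ r * v
    scaled a b c v h r hr = frac-unique a (b ℕ.* c) (r * v)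
      (trans (cong (r * v *_) (R-ℕ* b c))
        (trans (solve 4 (λ r v b c → r :* v :* (b :* c) := r :* b :* (v :* c)) refl r v (R (+ b)) (R (+ c)))
          (trans (cong₂ _*_ hr h) (ℚₚ.*-identityʳ (R (+ a))))))
    instance
      k^≢0 : ∀ {j} → NonZero (k ℕ.^ j)
      k^≢0 {j} = ℕₚ.m^n≢0 k j
      5k⁴≢0 : NonZero (5 ℕ.* k ℕ.^ 4)
      5k⁴≢0 = ℕₚ.m*n≢0 5 (k ℕ.^ 4)
    parts : λk k ≡ (+ 1 / 10) - (+ 1 / 2) * κ + κ² - κ³ + (+ 2 / 5) * κ⁴
    parts = cong₂ _+_ (cong₂ _-_ (cong₂ _+_ (cong (λ x → (+ 1 / 10) - x)
        (scaled 1 2 k κ κK (+ 1 / 2) refl))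
        (frac-unique 1 (k ℕ.^ 2) κ² h²)) (frac-unique 1 (k ℕ.^ 3) κ³ h³)) (scaled 2 5 (k ℕ.^ 4) κ⁴ h⁴ (+ 2 / 5) refl)
    ring : ∀ κ → R (+ 10) * ((+ 1 / 10) - (+ 1 / 2) * κ + κ * (κ * 1ℚ) - κ * (κ * (κ * 1ℚ)) + (+ 2 / 5) * (κ * (κ * (κ * (κ * 1ℚ))))) ≡ g κ
    ring = solve 1 (λ κ → con (R (+ 10)) :* (con (+ 1 / 10) :- con (+ 1 / 2) :* κ :+ κ :* (κ :* con 1ℚ) :- κ :* (κ :* (κ :* con 1ℚ)) :+ con (+ 2 / 5) :* (κ :* (κ :* (κ :* (κ :* con 1ℚ)))))
      := (con 1ℚ :- κ) :* ((con 1ℚ :- κ) :- κ) :* ((con 1ℚ :- κ) :* (con 1ℚ :- κ) :+ κ :* κ)) refl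

  -- Continuity of g on the unit interval, and the archimedean property

  p≤∣p∣ : ∀ p → p ≤ ∣ p ∣
  p≤∣p∣ p with ℚₚ.≤-total 0ℚ p
  ... | inj₁ 0≤p = ℚₚ.≤-reflexive (sym (ℚₚ.0≤p⇒∣p∣≡p 0≤p))
  ... | inj₂ p≤0 = ℚₚ.≤-trans p≤0 (ℚₚ.0≤∣p∣ p)

  *-monoˡ : ∀ {c p q} → 0ℚ ≤ c → p ≤ q → c * p ≤ c * q
  *-monoˡ {c} 0≤c = ℚₚ.*-monoˡ-≤-nonNeg c {{nonNegative 0≤c}}

  *-monoʳ : ∀ {c p q} → 0ℚ ≤ c → p ≤ q → p * c ≤ q * c
  *-monoʳ {c} 0≤c = ℚₚ.*-monoʳ-≤-nonNeg c {{nonNegative 0≤c}}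

  0≤* : ∀ {p q} → 0ℚ ≤ p → 0ℚ ≤ q → 0ℚ ≤ p * q
  0≤* {p} {q} 0≤p 0≤q = subst (_≤ p * q) (ℚₚ.*-zeroʳ p) (*-monoˡ 0≤p 0≤q)

  R≥0 : ∀ n → 0ℚ ≤ R (+ n)
  R≥0 n = R-mono {+ 0} {+ n} (ℤ.+≤+ z≤n)

  p-q≤r⇒p≤r+q : ∀ {p q r} → p - q ≤ r → p ≤ r + q
  p-q≤r⇒p≤r+q {p} {q} {r} h = subst (_≤ r + q) (solve 2 (λ p q → p :- q :+ q := p) refl p q) (ℚₚ.+-monoˡ-≤ q h)

  p≤r+q⇒p-q≤r : ∀ {p q r} → p ≤ r + q → p - q ≤ r
  p≤r+q⇒p-q≤r {p} {q} {r} h = subst (p - q ≤_) (solve 2 (λ r q → r :+ q :- q := r) refl r q) (ℚₚ.+-monoˡ-≤ (- q) h)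

  record Unit (x : ℚ) : Set where
    constructor unit
    field
      0≤ : 0ℚ ≤ x
      ≤1 : x ≤ 1ℚ
  open Unit

  unit-* : ∀ {x y} → Unit x → Unit y → Unit (x * y)
  unit-* {x} {y} (unit 0≤x x≤1) (unit 0≤y y≤1) = unit (0≤* 0≤x 0≤y)
    (ℚₚ.≤-trans (*-monoˡ 0≤x y≤1) (subst (_≤ 1ℚ) (sym (ℚₚ.*-identityʳ x)) x≤1))

  unit-scale : ∀ {a p t} → Unit a → 0ℚ ≤ t → p ≤ t → a * p ≤ t
  unit-scale {a} {p} {t} (unit 0≤a a≤1) 0≤t p≤t = ℚₚ.≤-trans (*-monoˡ 0≤a p≤t)
    (subst (a * t ≤_) (ℚₚ.*-identityˡ t) (*-monoʳ 0≤t a≤1))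

  -- Uses ac - bd = d(a - b) + a(c - d). Multiplying by a factor from [0, 1] preserves an upper
  -- bound that is nonnegative, whatever the sign of the difference.
  *-close : ∀ {a b c d s t} → Unit a → Unit d → 0ℚ ≤ s → 0ℚ ≤ t → a - b ≤ s → c - d ≤ t → a * c - b * d ≤ s + t
  *-close {a} {b} {c} {d} {s} {t} ua ud 0≤s 0≤t h₁ h₂ = subst (_≤ s + t)
    (solve 4 (λ a b c d → d :* (a :- b) :+ a :* (c :- d) := a :* c :- b :* d) refl a b c d)
    (ℚₚ.+-mono-≤ (unit-scale ud 0≤s h₁) (unit-scale ua 0≤t h₂))

  module Powers {x y s : ℚ} (ux : Unit x) (uy : Unit y) (0≤s : 0ℚ ≤ s) (h : x - y ≤ s) where
    private
      0≤+ : ∀ {p q} → 0ℚ ≤ p → 0ℚ ≤ q → 0ℚ ≤ p + q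
      0≤+ = ℚₚ.+-mono-≤

    square-close : x * x - y * y ≤ s + s
    square-close = *-close ux uy 0≤s 0≤s h h

    cube-close : x * (x * x) - y * (y * y) ≤ s + (s + s)
    cube-close = *-close ux (unit-* uy uy) 0≤s (0≤+ 0≤s 0≤s) h square-close

    fourth-close : x * (x * (x * x)) - y * (y * (y * y)) ≤ s + (s + (s + s))
    fourth-close = *-close ux (unit-* uy (unit-* uy uy)) 0≤s (0≤+ 0≤s (0≤+ 0≤s 0≤s)) h cube-close

  -- Expanded by powers, the coefficients 5, 10, 10, 4 of g alternate in sign, so both one-sided
  -- bounds are used. A j-th power contributes j times s, and 5 + 2·10 + 3·10 + 4·4 = 71.
  g-lipschitz : ∀ {x y s} → Unit x → Unit y → 0ℚ ≤ s → x - y ≤ s → y - x ≤ s → g y - g x ≤ R (+ 71) * s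
  g-lipschitz {x} {y} {s} ux uy 0≤s x-y≤s y-x≤s = subst₂ _≤_
    (solve 2 (λ x y → con (R (+ 5)) :* (x :- y) :+ (con (R (+ 10)) :* (y :* y :- x :* x)
        :+ (con (R (+ 10)) :* (x :* (x :* x) :- y :* (y :* y)) :+ con (R (+ 4)) :* (y :* (y :* (y :* y)) :- x :* (x :* (x :* x)))))
      := (con 1ℚ :- y) :* ((con 1ℚ :- y) :- y) :* ((con 1ℚ :- y) :* (con 1ℚ :- y) :+ y :* y)
         :- (con 1ℚ :- x) :* ((con 1ℚ :- x) :- x) :* ((con 1ℚ :- x) :* (con 1ℚ :- x) :+ x :* x)) refl x y)
    (solve 1 (λ s → con (R (+ 5)) :* s :+ (con (R (+ 10)) :* (s :+ s)
        :+ (con (R (+ 10)) :* (s :+ (s :+ s)) :+ con (R (+ 4)) :* (s :+ (s :+ (s :+ s))))) := con (R (+ 71)) :* s) refl s)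
    (ℚₚ.+-mono-≤ (*-monoˡ (R≥0 5) x-y≤s)
      (ℚₚ.+-mono-≤ (*-monoˡ (R≥0 10) (Powers.square-close uy ux 0≤s y-x≤s))
        (ℚₚ.+-mono-≤ (*-monoˡ (R≥0 10) (Powers.cube-close ux uy 0≤s x-y≤s))
          (*-monoˡ (R≥0 4) (Powers.fourth-close uy ux 0≤s y-x≤s)))))

  archimedean : ∀ η → 0ℚ < η → Σ ℕ λ K → ∀ n → K ℕ.≤ n → 1ℚ < η * R (+ n)
  archimedean η 0<η = go η {{positive 0<η}}
    where
    go : ∀ η .{{_ : Positive η}} → Σ ℕ λ K → ∀ n → K ℕ.≤ n → 1ℚ < η * R (+ n)
    -- The denominator of η is `suc b`, and η times it is the numerator, hence at least 1; one
    -- further summand η makes the inequality strict.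
    go η@(mkℚ (+ suc a) b c) = suc (suc b) , λ n K≤n → ℚₚ.<-≤-trans bound
      (*-monoˡ (ℚₚ.<⇒≤ (ℚₚ.positive⁻¹ η)) (R-mono {+ suc (suc b)} {+ n} (ℤ.+≤+ K≤n)))
      where
      η*b≥1 : 1ℚ ≤ η * R (+ suc b)
      η*b≥1 = subst (1ℚ ≤_) (trans (sym (frac-* (suc a) (suc b))) (cong (_* R (+ suc b)) (ℚₚ.↥p/↧p≡p η))) (R-mono {+ 1} {+ suc a} (ℤ.+≤+ (s≤s z≤n)))
      bound : 1ℚ < η * R (+ suc (suc b))
      bound = subst₂ _<_ (ℚₚ.+-identityˡ 1ℚ)
        (trans (solve 2 (λ η r → η :+ η :* r := η :* (con 1ℚ :+ r)) refl η (R (+ suc b))) (cong (η *_) (sym (R-+ (+ 1) (+ suc b)))))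
        (ℚₚ.+-mono-<-≤ (ℚₚ.positive⁻¹ η) η*b≥1)

  -- Edge and pentagon densities of a single graph

  2*nC2 : ∀ n → 2 ℕ.* (suc n C 2) ≡ suc n ℕ.* n
  2*nC2 zero    = refl
  2*nC2 (suc n) = begin
    2 ℕ.* (suc (suc n) C 2)                  ≡⟨ cong (2 ℕ.*_) (nCk+nC[k+1]≡[n+1]C[k+1] (suc n) 1) ⟨
    2 ℕ.* (suc n C 1 ℕ.+ suc n C 2)          ≡⟨ ℕₚ.*-distribˡ-+ 2 (suc n C 1) (suc n C 2) ⟩
    2 ℕ.* (suc n C 1) ℕ.+ 2 ℕ.* (suc n C 2)  ≡⟨ cong₂ ℕ._+_ (cong (2 ℕ.*_) (nC1≡n (suc n))) (2*nC2 n) ⟩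
    2 ℕ.* suc n ℕ.+ suc n ℕ.* n              ≡⟨ ring n ⟩
    suc (suc n) ℕ.* suc n                    ∎
    where
    open ≡-Reasoning
    ring : ∀ n → 2 ℕ.* suc n ℕ.+ suc n ℕ.* n ≡ suc (suc n) ℕ.* suc n
    ring = ℕRing.solve-∀

  frac≥0 : ∀ a b → 0ℚ ≤ frac a b
  frac≥0 a zero    = ℚₚ.≤-refl
  frac≥0 a (suc b) = ℚₚ.nonNegative⁻¹ (frac a (suc b)) {{ℚₚ.normalize-nonNeg a (suc b)}}

  nC2-nonZero : ∀ n → 2 ℕ.≤ n → NonZero (n C 2)
  nC2-nonZero (suc (suc n)) (s≤s (s≤s z≤n)) =
    ℕₚ.m*n≢0⇒n≢0 2 {{subst NonZero (sym (2*nC2 (suc n))) _}}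

  R-pred : ∀ n → R (+ suc n) - 1ℚ ≡ R (+ n)
  R-pred n = trans (cong (_- 1ℚ) (R-+ (+ 1) (+ n))) (solve 1 (λ x → con 1ℚ :+ x :- con 1ℚ := x) refl (R (+ n)))

  edgeDensity-* : ∀ {n} (G : Graph n) → 2 ℕ.≤ n →
    edgeDensity G * (R (+ n) * (R (+ n) - 1ℚ)) ≡ R (+ 2) * R (+ numEdges G)
  edgeDensity-* {n@(suc n′)} G 2≤n = begin
    ρ * (R (+ n) * (R (+ n) - 1ℚ))   ≡⟨ cong (λ y → ρ * (R (+ n) * y)) (R-pred n′) ⟩
    ρ * (R (+ n) * R (+ n′))         ≡⟨ cong (ρ *_) (trans (sym (R-ℕ* n n′)) (trans (cong (λ y → R (+ y)) (sym (2*nC2 n′))) (R-ℕ* 2 (n C 2)))) ⟩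
    ρ * (R (+ 2) * R (+ (n C 2)))    ≡⟨ solve 3 (λ a b c → a :* (b :* c) := b :* (a :* c)) refl ρ (R (+ 2)) (R (+ (n C 2))) ⟩
    R (+ 2) * (ρ * R (+ (n C 2)))    ≡⟨ cong (R (+ 2) *_) (frac-* (numEdges G) (n C 2) {{nC2-nonZero n 2≤n}}) ⟩
    R (+ 2) * R (+ numEdges G)       ∎
    where
    open ≡-Reasoning
    ρ = edgeDensity G

  fifth : ℚ → ℚ
  fifth x = x * (x * (x * (x * x)))

  R-fifth : ∀ n → R (+ (n ℕ.^ 5)) ≡ fifth (R (+ n))
  R-fifth n = step (step (step (step (cong (λ y → R (+ y)) (ℕₚ.*-identityʳ n)))))
    where
    step : ∀ {a x} → R (+ a) ≡ x → R (+ (n ℕ.* a)) ≡ R (+ n) * x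
    step {a} e = trans (R-ℕ* n a) (cong (R (+ n) *_) e)

  dC5-* : ∀ {n} .{{_ : NonZero n}} (G : Graph n) → dC5 G * fifth (R (+ n)) ≡ R (+ νC5 G)
  dC5-* {n} G = trans (cong (dC5 G *_) (sym (R-fifth n))) (frac-* (νC5 G) (n ℕ.^ 5) {{ℕₚ.m^n≢0 n 5}})

  R-positive : ∀ n .{{_ : NonZero n}} → Positive (R (+ n))
  R-positive (suc n) = ℚₚ.normalize-pos (suc n) 1

  fifth-positive : ∀ x .{{_ : Positive x}} → Positive (fifth x)
  fifth-positive x = ℚₚ.pos*pos⇒pos x _ {{ℚₚ.pos*pos⇒pos x _ {{ℚₚ.pos*pos⇒pos x _ {{ℚₚ.pos*pos⇒pos x x}}}}}}

  module _ {n : ℕ} (G : Graph n) (2≤n : 2 ℕ.≤ n) where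
    private
      instance
        n≢0 : NonZero n
        n≢0 = ℕ.>-nonZero (ℕₚ.≤-trans (s≤s z≤n) 2≤n)

      N X ρ D : ℚ
      N = R (+ n)
      X = inv n
      ρ = edgeDensity G
      D = dC5 G

      M : ℤ
      M = + n ℤ.* + n ℤ.- + 2 ℤ.* + numEdges G

      XN : X * N ≡ 1ℚ
      XN = frac-* 1 n

    nonEdgeDensity : ℚ
    nonEdgeDensity = R M * (X * X)

    private
      x = nonEdgeDensity

      M≡xN² : R M ≡ x * (N * N)
      M≡xN² = begin
        R M                      ≡⟨ solve 1 (λ m → m := m :* (con 1ℚ :* con 1ℚ)) refl (R M) ⟩
        R M * (1ℚ * 1ℚ)          ≡⟨ cong (λ y → R M * (y * y)) XN ⟨
        R M * (X * N * (X * N))  ≡⟨ solve 3 (λ m X N → m :* (X :* N :* (X :* N)) := m :* (X :* X) :* (N :* N)) refl (R M) X N ⟩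
        x * (N * N)              ∎
        where open ≡-Reasoning

    -- Passing from pairs of distinct vertices to all n² ordered pairs multiplies the edge density
    -- by 1 - 1/n, the diagonal being counted among the non-edges.
    nonEdgeDensity≡ : x ≡ 1ℚ - ρ * (1ℚ - X)
    nonEdgeDensity≡ = begin
      R M * (X * X)                                  ≡⟨ cong (_* (X * X)) (trans (R-- (+ n ℤ.* + n) (+ 2 ℤ.* + numEdges G)) (cong₂ _-_ (R-* (+ n) (+ n)) (R-* (+ 2) (+ numEdges G)))) ⟩
      (N * N - R (+ 2) * R (+ numEdges G)) * (X * X) ≡⟨ cong (λ y → (N * N - y) * (X * X)) (edgeDensity-* G 2≤n) ⟨
      (N * N - ρ * (N * (N - 1ℚ))) * (X * X)         ≡⟨ solve 3 (λ N X ρ → (N :* N :- ρ :* (N :* (N :- con 1ℚ))) :* (X :* X)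
                                                          := X :* N :* (X :* N) :- ρ :* (X :* N) :* (X :* N :- X)) refl N X ρ ⟩
      X * N * (X * N) - ρ * (X * N) * (X * N - X)    ≡⟨ cong (λ y → y * y - ρ * y * (y - X)) XN ⟩
      1ℚ * 1ℚ - ρ * 1ℚ * (1ℚ - X)                    ≡⟨ solve 2 (λ ρ X → con 1ℚ :* con 1ℚ :- ρ :* con 1ℚ :* (con 1ℚ :- X) := con 1ℚ :- ρ :* (con 1ℚ :- X)) refl ρ X ⟩
      1ℚ - ρ * (1ℚ - X)                              ∎
      where open ≡-Reasoning

    private
      X≥0 : 0ℚ ≤ X
      X≥0 = frac≥0 1 n

      X≤1 : X ≤ 1ℚ
      X≤1 = subst₂ _≤_ (ℚₚ.*-identityʳ X) XN (*-monoˡ X≥0 (R-mono {+ 1} {+ n} (ℤ.+≤+ (ℕₚ.≤-trans (s≤s z≤n) 2≤n))))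

    nonEdgeDensity-unit : Unit x
    nonEdgeDensity-unit = unit
      (0≤* (R-mono {+ 0} {M} (nonEdges-count≥0 G)) (0≤* X≥0 X≥0))
      (subst₂ _≤_ (ℚₚ.+-identityʳ x) (trans (cong (_+ ρ * (1ℚ - X)) nonEdgeDensity≡) (solve 1 (λ y → con 1ℚ :- y :+ y := con 1ℚ) refl (ρ * (1ℚ - X))))
        (ℚₚ.+-monoʳ-≤ x (0≤* (frac≥0 (numEdges G) (n C 2)) (subst (_≤ 1ℚ - X) (ℚₚ.+-inverseʳ X) (ℚₚ.+-monoˡ-≤ (- X) X≤1)))))

    private
      n⁴ : ℕ
      n⁴ = n ℕ.* (n ℕ.* (n ℕ.* n))

      +n⁴ : + n⁴ ≡ Labelled.N⁴ G
      +n⁴ = trans (ℤₚ.pos-* n _) (cong (+ n ℤ.*_) (trans (ℤₚ.pos-* n _) (cong (+ n ℤ.*_) (ℤₚ.pos-* n n))))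

      N³ N⁴ : ℚ
      N³ = N * N * N
      N⁴ = N * (N * (N * N))

      R-N⁴ : R (Labelled.N⁴ G) ≡ N⁴
      R-N⁴ = trans (R-* (+ n) _) (cong (N *_) (trans (R-* (+ n) _) (cong (N *_) (R-* (+ n) (+ n)))))

      R-N³ : R (+ n ℤ.* + n ℤ.* + n) ≡ N³
      R-N³ = trans (R-* (+ n ℤ.* + n) (+ n)) (cong (_* N) (R-* (+ n) (+ n)))

      N⁸ : ℚ
      N⁸ = N³ * fifth N

      N⁸-positive : Positive N⁸
      N⁸-positive = ℚₚ.pos*pos⇒pos N³ {{ℚₚ.pos*pos⇒pos (N * N) {{ℚₚ.pos*pos⇒pos N {{pN}} N {{pN}}}} N {{pN}}}} (fifth N) {{fifth-positive N {{pN}}}}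
        where
        pN : Positive N
        pN = R-positive n

    -- The remainder modulo 10 lost in `νC5` is below 10, hence at most 10 n⁴; together with the 10
    -- n⁴ for degenerate walks this gives 20.
    labelled≤ν : + labelledC5 G ℤ.+ + 10 ℤ.* Labelled.N⁴ G ℤ.≤ + 10 ℤ.* + νC5 G ℤ.+ + 20 ℤ.* Labelled.N⁴ G
    labelled≤ν = subst₂ ℤ._≤_
      (cong (λ y → + L ℤ.+ y) (trans (ℤₚ.pos-* 10 n⁴) (cong (+ 10 ℤ.*_) +n⁴)))
      (cong₂ ℤ._+_ (ℤₚ.pos-* 10 ν) (trans (ℤₚ.pos-* 20 n⁴) (cong (+ 20 ℤ.*_) +n⁴)))
      (ℤ.+≤+ bound)
      where
      L ν : ℕ
      L = labelledC5 G
      ν = νC5 G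
      1≤n⁴ : 1 ℕ.≤ n⁴
      1≤n⁴ = ℕ.>-nonZero⁻¹ n⁴ {{ℕₚ.m*n≢0 n (n ℕ.* (n ℕ.* n)) {{n≢0}} {{ℕₚ.m*n≢0 n (n ℕ.* n) {{n≢0}} {{ℕₚ.m*n≢0 n n}}}}}}
      ring : ∀ q ν → 10 ℕ.* q ℕ.+ ν ℕ.* 10 ℕ.+ 10 ℕ.* q ≡ 10 ℕ.* ν ℕ.+ 20 ℕ.* q
      ring = ℕRing.solve-∀
      bound : L ℕ.+ 10 ℕ.* n⁴ ℕ.≤ 10 ℕ.* ν ℕ.+ 20 ℕ.* n⁴
      bound = subst (L ℕ.+ 10 ℕ.* n⁴ ℕ.≤_) (ring n⁴ ν) (ℕₚ.+-monoˡ-≤ (10 ℕ.* n⁴)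
        (subst (ℕ._≤ 10 ℕ.* n⁴ ℕ.+ ν ℕ.* 10) (sym (m≡m%n+[m/n]*n L 10))
          (ℕₚ.+-monoˡ-≤ (ν ℕ.* 10) (ℕₚ.≤-trans (ℕₚ.<⇒≤ (m%n<n L 10)) (ℕₚ.*-monoʳ-≤ 10 1≤n⁴)))))

    -- The integer bound divided by N⁸: three powers come from the scaling of the inequality and
    -- five from `dC5`, so the error of order n⁴ becomes 20/n.
    g-nonEdgeDensity≤ : g x ≤ R (+ 10) * D + R (+ 20) * X
    g-nonEdgeDensity≤ = ℚₚ.*-cancelʳ-≤-pos N⁸ {{N⁸-positive}} (subst₂ _≤_ lhs rhs (R-mono {c5Form (+ n) M} scaled))
      where
      open ≡-Reasoning
      rhsℤ : ℤ
      rhsℤ = + n ℤ.* + n ℤ.* + n ℤ.* (+ 10 ℤ.* + νC5 G ℤ.+ + 20 ℤ.* Labelled.N⁴ G)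
      scaled : c5Form (+ n) M ℤ.≤ rhsℤ
      scaled = ℤₚ.≤-trans (labelled-lower G) (N³-mono G labelled≤ν)
      form : ℚ → ℚ → ℚ
      form N m = (N * N - m) * (N * N - m - m) * ((N * N - m) * (N * N - m) + m * m)
      lhs : R (c5Form (+ n) M) ≡ g x * N⁸
      lhs = begin
        R (c5Form (+ n) M)   ≡⟨ trans (R-* (y ℤ.* (y ℤ.- M)) _) (cong₂ _*_
                                  (trans (R-* y (y ℤ.- M)) (cong₂ _*_ Ry (trans (R-- y M) (cong (_- R M) Ry))))
                                  (trans (R-+ (y ℤ.* y) (M ℤ.* M)) (cong₂ _+_ (trans (R-* y y) (cong₂ _*_ Ry Ry)) (R-* M M)))) ⟩
        form N (R M)         ≡⟨ cong (form N) M≡xN² ⟩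
        form N (x * (N * N)) ≡⟨ solve 2 (λ N x → let m = x :* (N :* N) in
                                  (N :* N :- m) :* (N :* N :- m :- m) :* ((N :* N :- m) :* (N :* N :- m) :+ m :* m)
                                  := (con 1ℚ :- x) :* ((con 1ℚ :- x) :- x) :* ((con 1ℚ :- x) :* (con 1ℚ :- x) :+ x :* x)
                                     :* (N :* N :* N :* (N :* (N :* (N :* (N :* N)))))) refl N x ⟩
        g x * N⁸             ∎
        where
        y : ℤ
        y = + n ℤ.* + n ℤ.- M
        Ry : R y ≡ N * N - R M
        Ry = trans (R-- (+ n ℤ.* + n) M) (cong (_- R M) (R-* (+ n) (+ n)))
      rhs : R rhsℤ ≡ (R (+ 10) * D + R (+ 20) * X) * N⁸
      rhs = begin
        R rhsℤ                                                    ≡⟨ trans (R-* (+ n ℤ.* + n ℤ.* + n) _) (cong₂ _*_ R-N³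
                                                                       (trans (R-+ (+ 10 ℤ.* + νC5 G) _) (cong₂ _+_ (R-* (+ 10) (+ νC5 G)) (trans (R-* (+ 20) (Labelled.N⁴ G)) (cong (R (+ 20) *_) R-N⁴))))) ⟩
        N³ * (R (+ 10) * R (+ νC5 G) + R (+ 20) * N⁴)             ≡⟨ cong₂ (λ a b → N³ * (R (+ 10) * a + R (+ 20) * b)) (sym (dC5-* G))
                                                                       (trans (sym (ℚₚ.*-identityˡ N⁴)) (cong (_* N⁴) (sym XN))) ⟩
        N³ * (R (+ 10) * (D * fifth N) + R (+ 20) * (X * N * N⁴)) ≡⟨ solve 5 (λ a b D X N → N :* N :* N :* (a :* (D :* (N :* (N :* (N :* (N :* N))))) :+ b :* (X :* N :* (N :* (N :* (N :* N)))))
                                                                       := (a :* D :+ b :* X) :* (N :* N :* N :* (N :* (N :* (N :* (N :* N)))))) refl (R (+ 10)) (R (+ 20)) D X N ⟩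
        (R (+ 10) * D + R (+ 20) * X) * N⁸                        ∎

  -- The lower bound

  inv-unit : ∀ k .{{_ : NonZero k}} → Unit (inv k)
  inv-unit k@(suc _) = unit (frac≥0 1 k)
    (subst₂ _≤_ (ℚₚ.*-identityʳ (inv k)) (frac-* 1 k) (*-monoˡ (frac≥0 1 k) (R-mono {+ 1} {+ k} (ℤ.+≤+ (s≤s z≤n)))))

  ≤-cancel-10 : ∀ {p q} → R (+ 10) * p ≤ R (+ 10) * q → p ≤ q
  ≤-cancel-10 = ℚₚ.*-cancelˡ-≤-pos (R (+ 10))

  lowerBound : ∀ k .{{_ : NonZero k}} → C5LowerBound (pk k) (λk k)
  -- The threshold 2 makes `n C 2` nonzero, and `K` forces `inv n` to be at most η.
  lowerBound k ε 0<ε = η , 0<η , 2 ℕ.⊔ K , bound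
    where
    η : ℚ
    -- The non-edge density is within 3η of `inv k`, so the total error is (71·3 + 20)η = 233η. It
    -- has to stay below 10ε, which is 400η.
    η = (+ 1 / 40) * ε
    0<η : 0ℚ < η
    0<η = ℚₚ.positive⁻¹ η {{ℚₚ.pos*pos⇒pos (+ 1 / 40) ε {{positive 0<ε}}}}
    0≤η : 0ℚ ≤ η
    0≤η = ℚₚ.<⇒≤ 0<η
    K : ℕ
    K = proj₁ (archimedean η 0<η)
    bound : ∀ n → 2 ℕ.⊔ K ℕ.≤ n → (G : Graph n) → ∣ edgeDensity G - pk k ∣ < η → λk k - ε ≤ dC5 G
    bound n n≥ G close = p≤r+q⇒p-q≤r {λk k} {ε} {dC5 G} (≤-cancel-10 {λk k} {dC5 G + ε} (begin
      R (+ 10) * λk k                                      ≡⟨ 10λ≡g k ⟩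
      g κ                                                  ≤⟨ p-q≤r⇒p≤r+q (g-lipschitz (nonEdgeDensity-unit G 2≤n) (inv-unit k) 0≤s x-κ≤s κ-x≤s) ⟩
      R (+ 71) * s + g x                                   ≤⟨ ℚₚ.+-monoʳ-≤ (R (+ 71) * s) (g-nonEdgeDensity≤ G 2≤n) ⟩
      R (+ 71) * s + (R (+ 10) * D + R (+ 20) * X)         ≤⟨ ℚₚ.+-monoʳ-≤ (R (+ 71) * s) (ℚₚ.+-monoʳ-≤ (R (+ 10) * D) (*-monoˡ (R≥0 20) X≤η)) ⟩
      R (+ 71) * s + (R (+ 10) * D + R (+ 20) * η)         ≡⟨ solve 2 (λ D η → con (R (+ 71)) :* (con (R (+ 3)) :* η) :+ (con (R (+ 10)) :* D :+ con (R (+ 20)) :* η)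
                                                                := con (R (+ 10)) :* D :+ con (R (+ 233)) :* η) refl D η ⟩
      R (+ 10) * D + R (+ 233) * η                         ≤⟨ ℚₚ.+-monoʳ-≤ (R (+ 10) * D) (*-monoʳ 0≤η (R-mono {+ 233} {+ 400} (ℤ.+≤+ (ℕₚ.m≤m+n 233 167)))) ⟩
      R (+ 10) * D + R (+ 400) * η                         ≡⟨ solve 2 (λ D ε → con (R (+ 10)) :* D :+ con (R (+ 400)) :* (con (+ 1 / 40) :* ε)
                                                                := con (R (+ 10)) :* (D :+ ε)) refl D ε ⟩
      R (+ 10) * (D + ε)                                   ∎))
      where
      open ℚₚ.≤-Reasoning
      2≤n : 2 ℕ.≤ n
      2≤n = ℕₚ.≤-trans (ℕₚ.m≤m⊔n 2 K) n≥
      instance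
        n≢0 : NonZero n
        n≢0 = ℕ.>-nonZero (ℕₚ.≤-trans (s≤s z≤n) 2≤n)
      κ x s D X ρ p : ℚ
      κ = inv k
      x = nonEdgeDensity G 2≤n
      s = R (+ 3) * η
      D = dC5 G
      X = inv n
      ρ = edgeDensity G
      p = pk k
      0≤s : 0ℚ ≤ s
      0≤s = 0≤* (R≥0 3) 0≤η
      uX : Unit X
      uX = inv-unit n
      X≤η : X ≤ η
      X≤η = begin
        X                  ≡⟨ ℚₚ.*-identityʳ X ⟨
        X * 1ℚ             ≤⟨ *-monoˡ (Unit.0≤ uX) (ℚₚ.<⇒≤ (proj₂ (archimedean η 0<η) n (ℕₚ.≤-trans (ℕₚ.m≤n⊔m 2 K) n≥))) ⟩
        X * (η * R (+ n))  ≡⟨ solve 3 (λ X η N → X :* (η :* N) := X :* N :* η) refl X η (R (+ n)) ⟩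
        X * R (+ n) * η    ≡⟨ cong (_* η) (frac-* 1 n) ⟩
        1ℚ * η             ≡⟨ ℚₚ.*-identityˡ η ⟩
        η                  ∎
      ρ-p≤η : ρ - p ≤ η
      ρ-p≤η = ℚₚ.≤-trans (p≤∣p∣ (ρ - p)) (ℚₚ.<⇒≤ close)
      p-ρ≤η : p - ρ ≤ η
      p-ρ≤η = ℚₚ.≤-trans (p≤∣p∣ (p - ρ)) (subst (_≤ η) (trans (sym (ℚₚ.∣-p∣≡∣p∣ (ρ - p)))
        (cong ∣_∣ (solve 2 (λ ρ p → :- (ρ :- p) := p :- ρ) refl ρ p))) (ℚₚ.<⇒≤ close))
      p≤1 : p ≤ 1ℚ
      p≤1 = p≤r+q⇒p-q≤r {1ℚ} {κ} {1ℚ} (subst (_≤ 1ℚ + κ) (ℚₚ.+-identityʳ 1ℚ) (ℚₚ.+-monoʳ-≤ 1ℚ (frac≥0 1 k)))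
      Xρ≤2η : X * ρ ≤ η + η
      -- Here ρ is bounded through its closeness to p, by η + 1; then `X` is at most 1 against the
      -- first summand and at most η against the second.
      Xρ≤2η = begin
        X * ρ              ≤⟨ *-monoˡ (Unit.0≤ uX) (p-q≤r⇒p≤r+q ρ-p≤η) ⟩
        X * (η + p)        ≤⟨ *-monoˡ (Unit.0≤ uX) (ℚₚ.+-monoʳ-≤ η p≤1) ⟩
        X * (η + 1ℚ)       ≡⟨ solve 2 (λ X η → X :* (η :+ con 1ℚ) := X :* η :+ X) refl X η ⟩
        X * η + X          ≤⟨ ℚₚ.+-mono-≤ (unit-scale uX 0≤η ℚₚ.≤-refl) X≤η ⟩
        η + η              ∎
      x-κ≤s : x - κ ≤ s
      x-κ≤s = begin
        x - κ                      ≡⟨ cong (_- κ) (nonEdgeDensity≡ G 2≤n) ⟩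
        1ℚ - ρ * (1ℚ - X) - κ      ≡⟨ solve 3 (λ ρ X κ → con 1ℚ :- ρ :* (con 1ℚ :- X) :- κ := (con 1ℚ :- κ :- ρ) :+ X :* ρ) refl ρ X κ ⟩
        (p - ρ) + X * ρ            ≤⟨ ℚₚ.+-mono-≤ p-ρ≤η Xρ≤2η ⟩
        η + (η + η)                ≡⟨ solve 1 (λ η → η :+ (η :+ η) := con (R (+ 3)) :* η) refl η ⟩
        s                          ∎
      κ-x≤s : κ - x ≤ s
      κ-x≤s = begin
        κ - x                      ≡⟨ cong (λ y → κ - y) (nonEdgeDensity≡ G 2≤n) ⟩
        κ - (1ℚ - ρ * (1ℚ - X))    ≡⟨ solve 3 (λ ρ X κ → κ :- (con 1ℚ :- ρ :* (con 1ℚ :- X)) := (ρ :- (con 1ℚ :- κ)) :- X :* ρ) refl ρ X κ ⟩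
        (ρ - p) - X * ρ            ≤⟨ p≤r+q⇒p-q≤r (ℚₚ.≤-trans ρ-p≤η (subst (_≤ s + X * ρ) (ℚₚ.+-identityʳ η)
                                        (ℚₚ.+-mono-≤ η≤s (0≤* (Unit.0≤ uX) (frac≥0 (numEdges G) (n C 2)))))) ⟩
        s                          ∎
        where
        η≤s : η ≤ s
        η≤s = subst (_≤ s) (ℚₚ.*-identityˡ η) (*-monoʳ 0≤η (R-mono {+ 1} {+ 3} (ℤ.+≤+ (s≤s z≤n))))

  -- The upper bound

  module TuránDensities (k t : ℕ) (2≤k : 2 ℕ.≤ k) .{{_ : NonZero t}} where
    open Turán k t using (G; labelled-upper; numEdges-turán)

    private
      n : ℕ
      n = k ℕ.* t

      instance
        k≢0 : NonZero k
        k≢0 = ℕ.>-nonZero (ℕₚ.≤-trans (s≤s z≤n) 2≤k)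
        n≢0 : NonZero n
        n≢0 = ℕₚ.m*n≢0 k t

      2≤n : 2 ℕ.≤ n
      2≤n = ℕₚ.≤-trans 2≤k (ℕₚ.m≤m*n k t)

      N T κ X p ρ D : ℚ
      N = R (+ n)
      T = R (+ t)
      κ = inv k
      X = inv n
      p = pk k
      ρ = edgeDensity G
      D = dC5 G

      T≡κN : T ≡ κ * N
      T≡κN = begin
        T                    ≡⟨ ℚₚ.*-identityˡ T ⟨
        1ℚ * T               ≡⟨ cong (_* T) (frac-* 1 k) ⟨
        κ * R (+ k) * T      ≡⟨ ℚₚ.*-assoc κ (R (+ k)) T ⟩
        κ * (R (+ k) * T)    ≡⟨ cong (κ *_) (R-ℕ* k t) ⟨
        κ * N                ∎
        where open ≡-Reasoning

    -- Rounding down in `νC5` and dropping degenerate walks act in the same favourable direction,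
    -- and `T` is exactly `κ * N`, so the bound holds for every `t` and not only in the limit.
    dC5≤λ : D ≤ λk k
    dC5≤λ = ≤-cancel-10 {D} {λk k} (subst (R (+ 10) * D ≤_) (sym (10λ≡g k))
      (ℚₚ.*-cancelʳ-≤-pos (fifth N) {{fifth-positive N {{R-positive n}}}} (subst₂ _≤_ lhs rhs (R-mono {+ 10 ℤ.* + νC5 G} 10ν≤))))
      where
      open ≡-Reasoning
      rhsℤ a : ℤ
      a = + n ℤ.- + t
      rhsℤ = + n ℤ.* (a ℤ.* (a ℤ.- + t) ℤ.* (a ℤ.* a ℤ.+ + t ℤ.* + t))
      10ν≤ : + 10 ℤ.* + νC5 G ℤ.≤ rhsℤ
      10ν≤ = ℤₚ.≤-trans (subst (ℤ._≤ + labelledC5 G) (trans (ℤₚ.pos-* (νC5 G) 10) (ℤₚ.*-comm (+ νC5 G) (+ 10)))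
        (ℤ.+≤+ (m/n*n≤m (labelledC5 G) 10))) labelled-upper
      lhs : R (+ 10 ℤ.* + νC5 G) ≡ R (+ 10) * D * fifth N
      lhs = trans (R-* (+ 10) (+ νC5 G)) (trans (cong (R (+ 10) *_) (sym (dC5-* G))) (sym (ℚₚ.*-assoc (R (+ 10)) D (fifth N))))
      Ra : R a ≡ N - T
      Ra = R-- (+ n) (+ t)
      form : ℚ → ℚ → ℚ
      form N T = N * ((N - T) * (N - T - T) * ((N - T) * (N - T) + T * T))
      rhs : R rhsℤ ≡ g κ * fifth N
      rhs = begin
        R rhsℤ            ≡⟨ trans (R-* (+ n) _) (cong (N *_) (trans (R-* (a ℤ.* (a ℤ.- + t)) _) (cong₂ _*_
                               (trans (R-* a (a ℤ.- + t)) (cong₂ _*_ Ra (trans (R-- a (+ t)) (cong (_- T) Ra))))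
                               (trans (R-+ (a ℤ.* a) (+ t ℤ.* + t)) (cong₂ _+_ (trans (R-* a a) (cong₂ _*_ Ra Ra)) (R-* (+ t) (+ t))))))) ⟩
        form N T          ≡⟨ cong (form N) T≡κN ⟩
        form N (κ * N)    ≡⟨ solve 2 (λ N κ → let T = κ :* N in
                               N :* ((N :- T) :* (N :- T :- T) :* ((N :- T) :* (N :- T) :+ T :* T))
                               := (con 1ℚ :- κ) :* ((con 1ℚ :- κ) :- κ) :* ((con 1ℚ :- κ) :* (con 1ℚ :- κ) :+ κ :* κ)
                                  :* (N :* (N :* (N :* (N :* N))))) refl N κ ⟩
        g κ * fifth N     ∎

    -- The graph has pN² / 2 edges, so ρ = pN / (N - 1) and the excess ρ - p equals p / (N - 1):
    -- nonnegative, and vanishing as N grows.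
    density-excess : (ρ - p) * (N - 1ℚ) ≡ p
    density-excess = begin
      (ρ - p) * (N - 1ℚ)                          ≡⟨ solve 3 (λ ρ p N → (ρ :- p) :* (N :- con 1ℚ) := con 1ℚ :* ρ :* (N :- con 1ℚ) :- p :* (N :- con 1ℚ)) refl ρ p N ⟩
      1ℚ * ρ * (N - 1ℚ) - p * (N - 1ℚ)            ≡⟨ cong (λ y → y * ρ * (N - 1ℚ) - p * (N - 1ℚ)) XN ⟨
      X * N * ρ * (N - 1ℚ) - p * (N - 1ℚ)         ≡⟨ solve 4 (λ X N ρ q → X :* N :* ρ :* (N :- con 1ℚ) :- q := X :* (ρ :* (N :* (N :- con 1ℚ))) :- q) refl X N ρ (p * (N - 1ℚ)) ⟩
      X * (ρ * (N * (N - 1ℚ))) - p * (N - 1ℚ)     ≡⟨ cong (λ y → X * y - p * (N - 1ℚ)) 2e ⟩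
      X * (N * N - N * (κ * N)) - p * (N - 1ℚ)    ≡⟨ solve 4 (λ X N κ q → X :* (N :* N :- N :* (κ :* N)) :- q := X :* N :* (N :* (con 1ℚ :- κ)) :- q) refl X N κ (p * (N - 1ℚ)) ⟩
      X * N * (N * p) - p * (N - 1ℚ)              ≡⟨ cong (λ y → y * (N * p) - p * (N - 1ℚ)) XN ⟩
      1ℚ * (N * p) - p * (N - 1ℚ)                 ≡⟨ solve 2 (λ N p → con 1ℚ :* (N :* p) :- p :* (N :- con 1ℚ) := p) refl N p ⟩
      p                                           ∎
      where
      open ≡-Reasoning
      XN : X * N ≡ 1ℚ
      XN = frac-* 1 n
      2e : ρ * (N * (N - 1ℚ)) ≡ N * N - N * (κ * N)
      2e = begin
        ρ * (N * (N - 1ℚ))                       ≡⟨ edgeDensity-* G 2≤n ⟩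
        R (+ 2) * R (+ numEdges G)               ≡⟨ R-* (+ 2) (+ numEdges G) ⟨
        R (+ 2 ℤ.* + numEdges G)                 ≡⟨ cong R numEdges-turán ⟩
        R (+ n ℤ.* + n ℤ.- + n ℤ.* + t)          ≡⟨ trans (R-- (+ n ℤ.* + n) (+ n ℤ.* + t)) (cong₂ _-_ (R-* (+ n) (+ n)) (R-* (+ n) (+ t))) ⟩
        N * N - N * T                            ≡⟨ cong (λ y → N * N - N * y) T≡κN ⟩
        N * N - N * (κ * N)                      ∎

    density-close : ∀ δ → 1ℚ < δ * R (+ ℕ.pred n) → ∣ ρ - p ∣ < δ
    density-close δ 1<δN = subst (_< δ) (sym (ℚₚ.0≤p⇒∣p∣≡p ρ-p≥0)) ρ-p<δ
      where
      N₁ : ℚ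
      N₁ = R (+ ℕ.pred n)
      N-1≡N₁ : N - 1ℚ ≡ N₁
      N-1≡N₁ = trans (cong (λ j → R (+ j) - 1ℚ) (sym (ℕₚ.suc-pred n))) (R-pred (ℕ.pred n))
      excess : (ρ - p) * N₁ ≡ p
      excess = trans (cong ((ρ - p) *_) (sym N-1≡N₁)) density-excess
      N₁-positive : Positive N₁
      N₁-positive = R-positive (ℕ.pred n) {{ℕ.>-nonZero (ℕₚ.pred-mono-≤ 2≤n)}}
      p≥0 : 0ℚ ≤ p
      p≥0 = subst (_≤ p) (ℚₚ.+-inverseʳ κ) (ℚₚ.+-monoˡ-≤ (- κ) (Unit.≤1 (inv-unit k)))
      p≤1 : p ≤ 1ℚ
      p≤1 = p≤r+q⇒p-q≤r {1ℚ} {κ} {1ℚ} (subst (_≤ 1ℚ + κ) (ℚₚ.+-identityʳ 1ℚ) (ℚₚ.+-monoʳ-≤ 1ℚ (Unit.0≤ (inv-unit k))))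
      ρ-p≥0 : 0ℚ ≤ ρ - p
      ρ-p≥0 = ℚₚ.*-cancelʳ-≤-pos N₁ {{N₁-positive}} (subst₂ _≤_ (sym (ℚₚ.*-zeroˡ N₁)) (sym excess) p≥0)
      ρ-p<δ : ρ - p < δ
      ρ-p<δ = ℚₚ.*-cancelʳ-<-nonNeg N₁ {{ℚₚ.pos⇒nonNeg N₁ {{N₁-positive}}}} (subst (_< δ * N₁) (sym excess) (ℚₚ.≤-<-trans p≤1 1<δN))

  upperBound : ∀ k → 2 ℕ.≤ k → C5UpperBound (pk k) (λk k)
  upperBound k 2≤k ε δ N₀ 0<ε 0<δ = k ℕ.* t , N₀≤n , turán k t ,
    density-close δ (proj₂ (archimedean δ 0<δ) (ℕ.pred (k ℕ.* t)) K≤n-1) ,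
    ℚₚ.≤-trans dC5≤λ (subst (_≤ λk k + ε) (ℚₚ.+-identityʳ (λk k)) (ℚₚ.+-monoʳ-≤ (λk k) (ℚₚ.<⇒≤ 0<ε)))
    where
    K t : ℕ
    K = proj₁ (archimedean δ 0<δ)
    -- The order is at least `t`, so it exceeds `N₀`, and the successor leaves room for `K` below
    -- the order minus one, the denominator of the density excess.
    t = suc (N₀ ℕ.+ K)
    open TuránDensities k t 2≤k
    t≤n : t ℕ.≤ k ℕ.* t
    t≤n = ℕₚ.m≤n*m t k {{ℕ.>-nonZero (ℕₚ.≤-trans (s≤s z≤n) 2≤k)}}
    N₀≤n : N₀ ℕ.≤ k ℕ.* t
    N₀≤n = ℕₚ.≤-trans (ℕₚ.m≤n⇒m≤1+n (ℕₚ.m≤m+n N₀ K)) t≤n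
    K≤n-1 : K ℕ.≤ ℕ.pred (k ℕ.* t)
    K≤n-1 = ℕₚ.≤-trans (ℕₚ.m≤n+m K N₀) (ℕₚ.pred-mono-≤ t≤n)

open import Data.Nat using (_≤_)

theorem1 : (k : ℕ) → 3 ≤ k → C5MinDensityIs (pk k) (λk k)
theorem1 k 3≤k =
  Densities.lowerBound k {{ℕ.>-nonZero (ℕₚ.≤-trans (s≤s z≤n) 3≤k)}} ,
  Densities.upperBound k (ℕₚ.≤-trans (s≤s (s≤s z≤n)) 3≤k)
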